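{- For every $\epsilon>0$ it holds that $M(\epsilon) \ge \operatorname{twr}(\lfloor 1/(16\epsilon) \rfloor)$. Equivalently: for every $\epsilon>0$ there exist a positive integer $n$ and a function $f:\mathbb{Z}_2^n\to[0,1]$ such that every $\epsilon$-regular subspace $H\le \mathbb{Z}_2^n$ for $f$ has index $|\mathbb{Z}_2^n/H| \ge \operatorname{twr}(\lfloor 1/(16\epsilon) \rfloor)$.
   Context: For an affine subspace $A$ of $\mathbb{Z}_2^n$ (a translate $A=H+g$ of a linear subspace $H\le\mathbb{Z}_2^n$) and a function $f:A\to[0,1]$, the Fourier coefficient of $f$ at $\eta\in\mathbb{Z}_2^n$ is $\widehat{f}(\eta)=\frac{1}{|A|}\sum_{x\in A} f(x)(-1)^{\langle x,\eta\rangle}$. Such $f$ is called $\epsilon$-regular if $\max_{\eta\notin H^\perp}|\widehat{f}(\eta)|\le\epsilon$. For $f:\mathbb{Z}_2^n\to[0,1]$ and an affine subspace $A$, $f|_A$ denotes the restriction of $f$ to $A$. The index of a subspace $H\le\mathbb{Z}_2^n$ is $|\mathbb{Z}_2^n/H|=2^{n-\dim H}$, the number of translates $H+g$. A subspace $H\le\mathbb{Z}_2^n$ is an $\epsilon$-regular subspace for $f:\mathbb{Z}_2^n\to[0,1]$ if $f|_A$ is $\epsilon$-regular for at least $(1-\epsilon)|\mathbb{Z}_2^n/H|$ translates $A$ of $H$. $M(\epsilon)$ denotes the least integer $M$ such that for every $n$ and every $f:\mathbb{Z}_2^n\to[0,1]$ there is an $\epsilon$-regular subspace for $f$ of index at most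 $M$ (this is finite by Green's arithmetic regularity lemma). The tower function is $\operatorname{twr}(0)=1$ and $\operatorname{twr}(h)=2^{\operatorname{twr}(h-1)}$ for positive integers $h$. -}

module Defs where

open import Data.Bool using (Bool; true; false; _xor_; _∧_; if_then_else_; T)
open import Data.Nat as ℕ using (ℕ; zero; suc)
open import Data.Integer as ℤ using (ℤ)
open import Data.Rational as ℚ using (ℚ; 0ℚ; 1ℚ; _+_; _*_; _-_; -_; _≤_; _<_; _/_; 1/_; floor; ∣_∣; Positive; positive)
open import Data.Rational.Properties using (pos*pos⇒pos; pos⇒nonZero)
open import Data.Vec using (Vec; []; _∷_; zipWith; replicate)
open import Data.List using (List; []; _∷_; map; _++_; filter; length)
open import Relation.Nullary using (¬_)
open import Relation.Nullary.Decidable using (Dec)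
open import Data.Product using (Σ; ∃; _×_; _,_)

𝔽₂^ : ℕ → Set
𝔽₂^ n = Vec Bool n

_⊕_ : ∀ {n} → 𝔽₂^ n → 𝔽₂^ n → 𝔽₂^ n
_⊕_ = zipWith _xor_

𝟎 : ∀ {n} → 𝔽₂^ n
𝟎 = replicate _ false

⟨_,_⟩ : ∀ {n} → 𝔽₂^ n → 𝔽₂^ n → Bool
⟨ [] , [] ⟩ = false
⟨ x ∷ xs , y ∷ ys ⟩ = (x ∧ y) xor ⟨ xs , ys ⟩

allVecs : (n : ℕ) → List (𝔽₂^ n)
allVecs zero = [] ∷ []
allVecs (suc n) = map (false ∷_) (allVecs n) ++ map (true ∷_) (allVecs n)

record Subspace (n : ℕ) : Set where
  field
    mem     : 𝔽₂^ n → Bool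
    has-𝟎   : T (mem 𝟎)
    closed⊕ : ∀ x y → T (mem x) → T (mem y) → T (mem (x ⊕ y))
open Subspace public

count : ∀ {A : Set} → (A → Bool) → List A → ℕ
count p [] = 0
count p (x ∷ xs) = if p x then suc (count p xs) else count p xs

sumℚ : ∀ {A : Set} → (A → ℚ) → List A → ℚ
sumℚ f [] = 0ℚ
sumℚ f (x ∷ xs) = f x + sumℚ f xs

-- a / b as a rational (b = 0 never occurs in our uses)
_÷ℕ_ : ℕ → ℕ → ℚ
a ÷ℕ zero = 0ℚ
a ÷ℕ suc b = ℤ.+ a / suc b

sign : Bool → ℚ
sign false = 1ℚ
sign true  = - 1ℚ

card : ∀ {n} → Subspace n → ℕ
card {n} H = count (mem H) (allVecs n)

-- index |Z_2^n / H| = 2^n / |H|   (exact division, |H| ≥ 1)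
index : ∀ {n} → Subspace n → ℕ
index {n} H with card H
... | zero  = 0
... | suc k = (2 ℕ.^ n) ℕ./ suc k

inTranslate : ∀ {n} → Subspace n → 𝔽₂^ n → 𝔽₂^ n → Bool
inTranslate H g x = mem H (x ⊕ g)

inPerp : ∀ {n} → Subspace n → 𝔽₂^ n → Bool
inPerp {n} H η = count (λ h → mem H h ∧ ⟨ h , η ⟩) (allVecs n) ℕ.≡ᵇ 0

fourier : ∀ {n} → (𝔽₂^ n → ℚ) → Subspace n → 𝔽₂^ n → 𝔽₂^ n → ℚ
fourier {n} f H g η =
  (1 ÷ℕ card H) *
  sumℚ (λ x → if inTranslate H g x then f x * sign ⟨ x , η ⟩ else 0ℚ) (allVecs n)

IsRegularOn : ∀ {n} → ℚ → (𝔽₂^ n → ℚ) → Subspace n → 𝔽₂^ n → Set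
IsRegularOn ε f H g = ∀ η → ¬ T (inPerp H η) → ∣ fourier f H g η ∣ ≤ ε

-- ε-regular subspace for f: f|_A is ε-regular for at least
-- (1-ε)·|Z_2^n/H| translates A of H.
--
-- The number of translates is counted via: the set of g ∈ Z_2^n with
-- f|_{H+g} ε-regular is a union of cosets of H, so the number of such
-- translates is (#such g) / |H|.  We ask for a decision procedure for
-- regularity on each translate; the number of good translates is then
-- computed from it.

record IsRegularSubspace {n : ℕ} (ε : ℚ) (f : 𝔽₂^ n → ℚ) (H : Subspace n) : Set where
  field
    good       : 𝔽₂^ n → Bool
    good-spec₁ : ∀ g → T (good g) → IsRegularOn ε f H g
    good-spec₂ : ∀ g → IsRegularOn ε f H g → T (good g)
    many       : (1ℚ - ε) * (ℤ.+ index H / 1) ≤ count good (allVecs n) ÷ℕ card H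

twr : ℕ → ℕ
twr zero = 1
twr (suc h) = 2 ℕ.^ twr h

towerBound : (ε : ℚ) → 0ℚ < ε → ℕ
towerBound ε ε>0 =
  twr (ℤ.∣ floor ((1/ (ℤ.+ 16 / 1 * ε)) {{pos⇒nonZero (ℤ.+ 16 / 1 * ε) {{pos*pos⇒pos (ℤ.+ 16 / 1) ε {{positive ε>0}}}}}}) ∣)

{-# OPTIONS --safe #-}

-- Split 𝔽₂ⁿ into s = ⌊1/(16ε)⌋ consecutive blocks, each exponentially longer than everything
-- before it. Every prefix x^{<i} selects a vector ξ(x^{<i}) in the space of the i-th block, in
-- such a way that every nonzero vector h of that space satisfies ⟨h, ξ⟩ = 1 for at least a
-- quarter of the prefixes; this asks for a linear code of relative distance 1/4 and positive
-- rate. Let f(x) be the fraction of blocks i with ⟨x^i, ξ(x^{<i})⟩ = 1.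
--
-- An ε-regular H must then be trivial. Otherwise let i be the first block on which some h ∈ H is
-- nonzero, so that the prefix x^{<i} is constant on the cosets of H. For a quarter of the
-- prefixes ξ(x^{<i}) is not orthogonal to H. On those, the i-th term of f contributes -1/(2s) to
-- the Fourier coefficient at ξ(x^{<i}), earlier terms contribute nothing, and later ones average
-- out over the translates of H. So the mean Fourier coefficient over all translates has size at
-- least 1/(8s) ≥ 2ε, whereas regularity bounds it by 1 - (1 - ε)² < 2ε.

module Submission where

open import Defs
open import Data.Bool using (Bool; true; false; not; _xor_; _∧_; _∨_; if_then_else_; T)
open import Data.Bool.Properties using (xor-comm; xor-assoc; xor-same; ∧-zeroʳ)
open import Data.Empty using (⊥-elim)
open import Data.Integer as ℤ using ()
import Data.Integer.DivMod as ℤ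
import Data.Integer.Properties as ℤₚ
open import Data.List as List using (List; []; _∷_)
open import Data.List.Membership.Propositional using (_∈_)
open import Data.List.Membership.Propositional.Properties using (∈-map⁺; ∈-++⁺ˡ; ∈-++⁺ʳ)
open import Data.List.Relation.Unary.Any as Any using ()
open import Data.Nat as ℕ using (ℕ; zero; suc)
import Data.Nat.DivMod as ℕ
import Data.Nat.Properties as ℕₚ
open import Data.Nat.Solver using () renaming (module +-*-Solver to ℕ-Solver)
open import Data.Product using (Σ; ∃; _×_; _,_)
import Data.Rational as ℚ
import Data.Rational.Properties as ℚₚ
open import Data.Rational.Solver using () renaming (module +-*-Solver to ℚ-Solver)
import Data.Rational.Unnormalised as ℚᵘ
import Data.Rational.Unnormalised.Properties as ℚᵘₚ
open import Data.Sum using (_⊎_; inj₁; inj₂)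
open import Data.Vec as Vec using ([]; _∷_; _++_; take; drop)
open import Data.Vec.Properties using (take++drop≡id; take-zipWith)
open import Function using (_∘_; case_of_)
open import Relation.Binary.PropositionalEquality
open import Relation.Nullary using (¬_; contradiction)

-- Counting in 𝔽₂ⁿ.

module Codes where

  open import Data.Nat using (_≤_; _<_; z≤n; s≤s; _+_; _*_; _^_; _<ᵇ_; >-nonZero)
  open ℕₚ

  -- A positive form of x ≠ 𝟎: a derivation locates a `true` entry, so that proofs can recurse down
  -- to it.
  data NonZeroVec : ∀ {n} → 𝔽₂^ n → Set where
    here  : ∀ {n} {x : 𝔽₂^ n} → NonZeroVec (true ∷ x)
    there : ∀ {n b} {x : 𝔽₂^ n} → NonZeroVec x → NonZeroVec (b ∷ x)

  zeroOrNonZero : ∀ {n} (x : 𝔽₂^ n) → x ≡ 𝟎 ⊎ NonZeroVec x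
  zeroOrNonZero []          = inj₁ refl
  zeroOrNonZero (true ∷ x)  = inj₂ here
  zeroOrNonZero (false ∷ x) with zeroOrNonZero x
  ... | inj₁ x≡𝟎 = inj₁ (cong (false ∷_) x≡𝟎)
  ... | inj₂ nz  = inj₂ (there nz)

  # : ∀ {n} → (𝔽₂^ n → Bool) → ℕ
  # {n} p = count p (allVecs n)

  count-++ : ∀ {A : Set} (p : A → Bool) xs ys → count p (xs List.++ ys) ≡ count p xs + count p ys
  count-++ p []       ys = refl
  count-++ p (x ∷ xs) ys with p x
  ... | true  = cong suc (count-++ p xs ys)
  ... | false = count-++ p xs ys

  count-map : ∀ {A B : Set} (p : B → Bool) (f : A → B) xs →
    count p (List.map f xs) ≡ count (p ∘ f) xs
  count-map p f []       = refl
  count-map p f (x ∷ xs) with p (f x)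
  ... | true  = cong suc (count-map p f xs)
  ... | false = count-map p f xs

  #-suc : ∀ {n} (p : 𝔽₂^ (suc n) → Bool) → # p ≡ # (p ∘ (false ∷_)) + # (p ∘ (true ∷_))
  #-suc {n} p = trans (count-++ p (List.map (false ∷_) (allVecs n)) _)
    (cong₂ _+_ (count-map p _ (allVecs n)) (count-map p _ (allVecs n)))

  2^suc : ∀ n → 2 ^ suc n ≡ 2 ^ n + 2 ^ n
  2^suc n = cong (2 ^ n +_) (+-identityʳ (2 ^ n))

  #-zero : ∀ {n} (p : 𝔽₂^ n → Bool) → # p ≡ 0 → ∀ x → p x ≡ false
  #-zero p eq [] with p []
  ... | false = refl
  #-zero p eq (false ∷ x) = #-zero (p ∘ (false ∷_)) (m+n≡0⇒m≡0 _ (trans (sym (#-suc p)) eq)) x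
  #-zero p eq (true ∷ x)  = #-zero (p ∘ (true ∷_))
      (m+n≡0⇒n≡0 (# (p ∘ (false ∷_))) (trans (sym (#-suc p)) eq)) x

  #-complement : ∀ {n} (p : 𝔽₂^ n → Bool) → # (not ∘ p) + # p ≡ 2 ^ n
  #-complement {zero} p with p []
  ... | true  = refl
  ... | false = refl
  #-complement {suc n} p
    rewrite #-suc p | #-suc (not ∘ p) | 2^suc n
          | sym (cong₂ _+_ (#-complement (p ∘ (false ∷_))) (#-complement (p ∘ (true ∷_))))
    = solve 4 (λ a b c d → (a :+ b) :+ (c :+ d) := (a :+ c) :+ (b :+ d)) refl
        (# (not ∘ p ∘ (false ∷_))) _ (# (p ∘ (false ∷_))) _
    where open ℕ-Solver

  sumℕ : ∀ {A : Set} → (A → ℕ) → List A → ℕ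
  sumℕ f []       = 0
  sumℕ f (x ∷ xs) = f x + sumℕ f xs

  sumℕ-cong : ∀ {A : Set} {f g : A → ℕ} → (∀ x → f x ≡ g x) → ∀ xs → sumℕ f xs ≡ sumℕ g xs
  sumℕ-cong f≗g []       = refl
  sumℕ-cong f≗g (x ∷ xs) = cong₂ _+_ (f≗g x) (sumℕ-cong f≗g xs)

  sumℕ-+ : ∀ {A : Set} (f g : A → ℕ) xs → sumℕ f xs + sumℕ g xs ≡ sumℕ (λ x → f x + g x) xs
  sumℕ-+ f g []       = refl
  sumℕ-+ f g (x ∷ xs) rewrite sym (sumℕ-+ f g xs) =
    solve 4 (λ a b c d → (a :+ b) :+ (c :+ d) := (a :+ c) :+ (b :+ d)) refl (f x) _ (g x) _
    where open ℕ-Solver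

  sumℕ-*ˡ : ∀ {A : Set} k (f : A → ℕ) xs → k * sumℕ f xs ≡ sumℕ (λ x → k * f x) xs
  sumℕ-*ˡ k f []       = *-zeroʳ k
  sumℕ-*ˡ k f (x ∷ xs) = trans (*-distribˡ-+ k (f x) _) (cong (k * f x +_) (sumℕ-*ˡ k f xs))

  term≤sumℕ : ∀ {A : Set} (f : A → ℕ) {x xs} → x ∈ xs → f x ≤ sumℕ f xs
  term≤sumℕ f (Any.here refl) = m≤m+n _ _
  term≤sumℕ f (Any.there x∈)  = ≤-trans (term≤sumℕ f x∈) (m≤n+m _ _)

  ∈-allVecs : ∀ {n} (x : 𝔽₂^ n) → x ∈ allVecs n
  ∈-allVecs []                  = Any.here refl
  ∈-allVecs {suc n} (false ∷ x) = ∈-++⁺ˡ (∈-map⁺ (false ∷_) (∈-allVecs x))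
  ∈-allVecs {suc n} (true ∷ x)  = ∈-++⁺ʳ (List.map (false ∷_) (allVecs n))
      (∈-map⁺ (true ∷_) (∈-allVecs x))

  #-true : ∀ n → # {n} (λ _ → true) ≡ 2 ^ n
  #-true zero    = refl
  #-true (suc n) = trans (#-suc {n} (λ _ → true))
      (trans (cong₂ _+_ (#-true n) (#-true n)) (sym (2^suc n)))

  sumℕ-1 : ∀ {A : Set} (xs : List A) → sumℕ (λ _ → 1) xs ≡ count (λ _ → true) xs
  sumℕ-1 []       = refl
  sumℕ-1 (x ∷ xs) = cong suc (sumℕ-1 xs)

  -- Greedy construction of linear codes.

  -- Method of conditional expectations: for a random v the left-hand sum has expectation
  -- (3/2)^(2^m) times the right-hand one, so the values of v can be fixed one at a time.
  chooseWord : ∀ m {I : Set} (is : List I) (w : I → ℕ) (c : I → 𝔽₂^ m → Bool) →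
    Σ (𝔽₂^ m → Bool) λ v →
      2 ^ (2 ^ m) * sumℕ (λ i → w i * 2 ^ (# (λ x → not (v x xor c i x)))) is
        ≤ 3 ^ (2 ^ m) * sumℕ w is
  chooseWord zero is w c = case ≤-total (S false) (S true) of λ where
      (inj₁ le) → (λ _ → false) , bound _ _ le total
      (inj₂ le) → (λ _ → true)  , bound _ _ le (trans (+-comm (S true) (S false)) total)
    where
    S : Bool → ℕ
    S b = sumℕ (λ i → w i * 2 ^ (# {0} (λ x → not (b xor c i x)))) is
    -- Exactly one of the two bits agrees with `c i []`, so the factors are 1 and 2 in some order.
    -- The sums for both bits thus total 3 times that of `w`, and the smaller is at most half of
    -- this.
    pointwise : ∀ i →
      w i * 2 ^ (# {0} (λ x → not (false xor c i x))) + w i * 2 ^ (# {0} (λ x → not (true xor c i x)))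
        ≡ 3 * w i
    pointwise i with c i []
    ... | true  = solve 1 (λ a → a :* con 1 :+ a :* con 2 := con 3 :* a) refl (w i)
      where open ℕ-Solver
    ... | false = solve 1 (λ a → a :* con 2 :+ a :* con 1 := con 3 :* a) refl (w i)
      where open ℕ-Solver
    total : S false + S true ≡ 3 * sumℕ w is
    total = trans (sumℕ-+ _ _ is) (trans (sumℕ-cong pointwise is) (sym (sumℕ-*ˡ 3 w is)))
    bound : ∀ a b → a ≤ b → a + b ≡ 3 * sumℕ w is → 2 * a ≤ 3 * sumℕ w is
    bound a b a≤b eq = ≤-trans (+-monoʳ-≤ a (≤-trans (≤-reflexive (+-identityʳ a)) a≤b))
        (≤-reflexive eq)
  chooseWord (suc m) is w c
    with chooseWord m is w (λ i → c i ∘ (false ∷_))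
  -- The agreements on the `false` half are absorbed into the weights before the `true` half is
  -- chosen, so the two bounds multiply.
  ... | v₀ , le₀
    with chooseWord m is (λ i → w i * 2 ^ (# (λ x → not (v₀ x xor c i (false ∷ x)))))
        (λ i → c i ∘ (true ∷_))
  ... | v₁ , le₁ = v , (begin
      2 ^ (2 ^ suc m) * sumℕ (λ i → w i * 2 ^ (# (λ x → not (v x xor c i x)))) is
        ≡⟨ cong₂ _*_ (pow 2) (sumℕ-cong split is) ⟩
      (2 ^ N * 2 ^ N) * sumℕ (λ i → w₁ i * 2 ^ (# (λ x → not (v₁ x xor c i (true ∷ x))))) is
        ≡⟨ *-assoc (2 ^ N) (2 ^ N) _ ⟩
      2 ^ N * (2 ^ N * sumℕ (λ i → w₁ i * 2 ^ (# (λ x → not (v₁ x xor c i (true ∷ x))))) is)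
        ≤⟨ *-monoʳ-≤ (2 ^ N) le₁ ⟩
      2 ^ N * (3 ^ N * sumℕ w₁ is)
        ≡⟨ solve 3 (λ a b c → a :* (b :* c) := b :* (a :* c)) refl (2 ^ N) (3 ^ N) (sumℕ w₁ is) ⟩
      3 ^ N * (2 ^ N * sumℕ w₁ is)
        ≤⟨ *-monoʳ-≤ (3 ^ N) le₀ ⟩
      3 ^ N * (3 ^ N * sumℕ w is)
        ≡⟨ *-assoc (3 ^ N) (3 ^ N) _ ⟨
      (3 ^ N * 3 ^ N) * sumℕ w is
        ≡⟨ cong (_* sumℕ w is) (pow 3) ⟨
      3 ^ (2 ^ suc m) * sumℕ w is ∎)
    where
    open ≤-Reasoning
    open ℕ-Solver
    N = 2 ^ m
    w₁ = λ i → w i * 2 ^ (# (λ x → not (v₀ x xor c i (false ∷ x))))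
    v : 𝔽₂^ (suc m) → Bool
    v (false ∷ x) = v₀ x
    v (true ∷ x)  = v₁ x
    pow : ∀ b → b ^ (2 ^ suc m) ≡ b ^ N * b ^ N
    pow b = trans (cong (b ^_) (2^suc m)) (^-distribˡ-+-* b N N)
    split : ∀ i → w i * 2 ^ (# (λ x → not (v x xor c i x)))
        ≡ w₁ i * 2 ^ (# (λ x → not (v₁ x xor c i (true ∷ x))))
    split i = trans
      (cong (w i *_)
          (trans (cong (2 ^_) (#-suc (λ x → not (v x xor c i x))))
          (^-distribˡ-+-* 2 (# (λ x → not (v₀ x xor c i (false ∷ x)))) _)))
      (sym (*-assoc (w i) _ _))

  -- A linear code of length 2 ^ m, dimension k and relative distance at least 1/4, presented by the
  -- columns ξ x of a generator matrix: the codeword of y is x ↦ ⟨ y , ξ x ⟩.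
  record Code (m k : ℕ) : Set where
    field
      ξ         : 𝔽₂^ m → 𝔽₂^ k
      ξ-nonZero : ∀ x → NonZeroVec (ξ x)
      distance  : ∀ y → NonZeroVec y → 2 ^ m ≤ 4 * # (λ x → ⟨ y , ξ x ⟩)
  open Code public

  -- Starting from the repetition code makes every column nonzero from the outset, and `extend`
  -- preserves this.
  code1 : ∀ m → Code m 1
  code1 m .ξ _ = true ∷ []
  code1 m .ξ-nonZero _ = here
  code1 m .distance (true ∷ []) here = ≤-trans (≤-reflexive (sym (#-true m))) (m≤n*m _ 4)

  ^-distribʳ-* : ∀ n a b → (a * b) ^ n ≡ a ^ n * b ^ n
  ^-distribʳ-* zero    a b = refl
  ^-distribʳ-* (suc n) a b rewrite ^-distribʳ-* n a b =
    solve 4 (λ a b c d → (a :* b) :* (c :* d) := (a :* c) :* (b :* d)) refl a b (a ^ n) (b ^ n)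
    where open ℕ-Solver

  -- Both sides are raised to the 8th power; then 2 ^ 14 > 3 ^ 8 * 2 does the rest.
  volume-bound : ∀ {N a w k} → a + w ≡ N → 8 * k ≤ N → 2 ^ N * 2 ^ a ≤ 3 ^ N * 2 ^ k → N ≤ 4 * w
  volume-bound {N} {a} {w} {k} a+w≡N 8k≤N le = ≮⇒≥ λ 4w<N → <-irrefl refl (begin-strict
      13122 ^ N
        <⟨ ^-monoˡ-< N {{>-nonZero (≤-trans (s≤s z≤n) 4w<N)}} (<ᵇ⇒< 13122 16384 _) ⟩
      16384 ^ N              ≡⟨ ^-*-assoc 2 14 N ⟩
      2 ^ (14 * N)           ≤⟨ ^-monoʳ-≤ 2 (exponent 4w<N) ⟩
      2 ^ ((N + a) * 8)
        ≡⟨ trans (cong (_^ 8) (sym (^-distribˡ-+-* 2 N a))) (^-*-assoc 2 (N + a) 8) ⟨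
      (2 ^ N * 2 ^ a) ^ 8    ≤⟨ ^-monoˡ-≤ 8 le ⟩
      (3 ^ N * 2 ^ k) ^ 8    ≡⟨ ^-distribʳ-* 8 (3 ^ N) (2 ^ k) ⟩
      (3 ^ N) ^ 8 * (2 ^ k) ^ 8
        ≡⟨ cong₂ _*_ (trans (^-*-assoc 3 N 8) (cong (3 ^_) (*-comm N 8)))
            (trans (^-*-assoc 2 k 8) (cong (2 ^_) (*-comm k 8))) ⟩
      3 ^ (8 * N) * 2 ^ (8 * k) ≤⟨ *-monoʳ-≤ (3 ^ (8 * N)) (^-monoʳ-≤ 2 8k≤N) ⟩
      3 ^ (8 * N) * 2 ^ N    ≡⟨ cong (_* 2 ^ N) (^-*-assoc 3 8 N) ⟨
      6561 ^ N * 2 ^ N       ≡⟨ ^-distribʳ-* N 6561 2 ⟨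
      13122 ^ N ∎)
    where
    open ≤-Reasoning
    -- From 4w < N and a + w = N follows a ≥ 3N/4, hence 8(N + a) ≥ 14N; this is the source of the
    -- exponent 14.
    exponent : 4 * w < N → 14 * N ≤ (N + a) * 8
    exponent 4w<N = +-cancelʳ-≤ (8 * w) _ _ (begin
      14 * N + 8 * w
        ≡⟨ solve 2 (λ n w → con 14 :* n :+ con 8 :* w :=
            con 14 :* n :+ con 2 :* (con 4 :* w)) refl N w ⟩
      14 * N + 2 * (4 * w)  ≤⟨ +-monoʳ-≤ (14 * N) (*-monoʳ-≤ 2 (<⇒≤ 4w<N)) ⟩
      14 * N + 2 * N
        ≡⟨ solve 1 (λ n → con 14 :* n :+ con 2 :* n := n :* con 8 :+ con 8 :* n) refl N ⟩
      N * 8 + 8 * N         ≡⟨ cong (λ t → N * 8 + 8 * t) a+w≡N ⟨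
      N * 8 + 8 * (a + w)
        ≡⟨ solve 3 (λ n a w → n :* con 8 :+ con 8 :* (a :+ w) :=
            (n :+ a) :* con 8 :+ con 8 :* w) refl N a w ⟩
      (N + a) * 8 + 8 * w   ∎)
      where open ℕ-Solver

  -- The new row `v` of the generator matrix has to be far from all 2 ^ k old codewords. With unit
  -- weights, `chooseWord` bounds the sum of 2 ^ (agreements) over them; each single term obeys the
  -- same bound, and `volume-bound` turns it into a distance.
  extend : ∀ {m k} → 8 * k ≤ 2 ^ m → Code m k → Code m (suc k)
  extend {m} {k} 8k≤2^m C with chooseWord m (allVecs k) (λ _ → 1) (λ y x → ⟨ y , C .ξ x ⟩)
  ... | v , le = record
    { ξ         = λ x → v x ∷ C .ξ x
    ; ξ-nonZero = λ x → there (C .ξ-nonZero x)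
    ; distance  = λ { (true ∷ y) _ → far y ; (false ∷ y) (there nz) → C .distance y nz }
    }
    where
    far : ∀ y → 2 ^ m ≤ 4 * # (λ x → v x xor ⟨ y , C .ξ x ⟩)
    far y = volume-bound {a = # (λ x → not (v x xor ⟨ y , C .ξ x ⟩))} {k = k}
        (#-complement (λ x → v x xor ⟨ y , C .ξ x ⟩)) 8k≤2^m
      (≤-trans (*-monoʳ-≤ (2 ^ (2 ^ m)) (≤-trans (≤-reflexive (sym (*-identityˡ _)))
          (term≤sumℕ (λ y → 1 * 2 ^ # (λ x → not (v x xor ⟨ y , C .ξ x ⟩))) (∈-allVecs y))))
        (≤-trans le (≤-reflexive (cong (3 ^ (2 ^ m) *_) (trans (sumℕ-1 (allVecs k)) (#-true k))))))

  gilbertVarshamov : ∀ m k → 8 * k ≤ 2 ^ m → Code m (suc k)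
  gilbertVarshamov m zero    _ = code1 m
  gilbertVarshamov m (suc k) h = extend h (gilbertVarshamov m k (≤-trans (*-monoʳ-≤ 8 (n≤1+n k)) h))

  -- Explicit short codes, and block lengths that keep up with the tower.

  identityCode : Code 1 2
  identityCode .ξ (false ∷ []) = true ∷ false ∷ []
  identityCode .ξ (true ∷ [])  = false ∷ true ∷ []
  identityCode .ξ-nonZero (false ∷ []) = here
  identityCode .ξ-nonZero (true ∷ [])  = there here
  identityCode .distance (true ∷ false ∷ []) _ = ≤ᵇ⇒≤ 2 4 _
  identityCode .distance (true ∷ true ∷ []) _ = ≤ᵇ⇒≤ 2 8 _
  identityCode .distance (false ∷ true ∷ []) _ = ≤ᵇ⇒≤ 2 4 _
  identityCode .distance (false ∷ false ∷ []) (there (there ()))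

  -- Five unit vectors, then the all-ones vector three times. A message of weight w has a codeword
  -- of weight w, plus 3 if w is odd, so every nonzero message reaches weight 2 out of 8.
  parityColumns : 𝔽₂^ 3 → 𝔽₂^ 5
  parityColumns (false ∷ false ∷ false ∷ []) = true ∷ false ∷ false ∷ false ∷ false ∷ []
  parityColumns (false ∷ false ∷ true ∷ [])  = false ∷ true ∷ false ∷ false ∷ false ∷ []
  parityColumns (false ∷ true ∷ false ∷ [])  = false ∷ false ∷ true ∷ false ∷ false ∷ []
  parityColumns (false ∷ true ∷ true ∷ [])   = false ∷ false ∷ false ∷ true ∷ false ∷ []
  parityColumns (true ∷ false ∷ false ∷ [])  = false ∷ false ∷ false ∷ false ∷ true ∷ []
  parityColumns (true ∷ _)                   = true ∷ true ∷ true ∷ true ∷ true ∷ []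

  parityCode : Code 3 5
  parityCode .ξ = parityColumns
  parityCode .ξ-nonZero (false ∷ false ∷ false ∷ []) = here
  parityCode .ξ-nonZero (false ∷ false ∷ true ∷ [])  = there here
  parityCode .ξ-nonZero (false ∷ true ∷ false ∷ [])  = there (there here)
  parityCode .ξ-nonZero (false ∷ true ∷ true ∷ [])   = there (there (there here))
  parityCode .ξ-nonZero (true ∷ false ∷ false ∷ [])  = there (there (there (there here)))
  parityCode .ξ-nonZero (true ∷ false ∷ true ∷ [])   = here
  parityCode .ξ-nonZero (true ∷ true ∷ _)            = here
  -- `bad` marks nonzero messages whose codeword is too light; `refl` lets evaluation run through
  -- all 32 vectors and find none.
  parityCode .distance y nz = ≮⇒≥ λ lt → subst T (#-zero bad refl y)
      (conj (or-nonZero nz) (<⇒<ᵇ lt))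
    where
    or : ∀ {n} → 𝔽₂^ n → Bool
    or []      = false
    or (b ∷ x) = b ∨ or x
    or-nonZero : ∀ {n} {x : 𝔽₂^ n} → NonZeroVec x → T (or x)
    or-nonZero here                  = _
    or-nonZero (there {b = true} nz)  = _
    or-nonZero (there {b = false} nz) = or-nonZero nz
    bad : 𝔽₂^ 5 → Bool
    bad y = or y ∧ (4 * # (λ x → ⟨ y , parityColumns x ⟩) <ᵇ 8)
    conj : ∀ {a b} → T a → T b → T (a ∧ b)
    conj {true} _ tb = tb

  -- For m < 4 the greedy code has dimension at most 2, too little for D to start outgrowing twr;
  -- the two explicit codes make up for it.
  dim : ℕ → ℕ
  dim 0 = 1
  dim 1 = 2
  dim 2 = 1
  dim 3 = 5
  dim (suc (suc (suc (suc m)))) = suc (2 ^ suc m)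

  code : ∀ m → Code m (dim m)
  code 0 = gilbertVarshamov 0 0 z≤n
  code 1 = identityCode
  code 2 = gilbertVarshamov 2 0 z≤n
  code 3 = parityCode
  -- Here 8 * 2 ^ (m + 1) equals the length 2 ^ (m + 4), so k is the largest that the greedy bound
  -- allows.
  code (suc (suc (suc (suc m)))) = gilbertVarshamov _ (2 ^ suc m)
      (≤-reflexive (solve 1 (λ a → con 8 :* a := con 2 :* (con 2 :* (con 2 :* a))) refl
      (2 ^ suc m)))
    where open ℕ-Solver

  -- Total length of the first i blocks. There are 2 ^ D i prefixes of that length, and they index
  -- the columns of the code whose dimension is the length of the next block.
  D : ℕ → ℕ
  D zero    = 0
  D (suc i) = D i + dim (D i)

  -- For m ≥ 4 the dimension is 1 + 2 ^ (m - 3), so a surplus of 4 over t leaves at least 2 ^ (t +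
  -- 1) = 2 ^ t + 2 ^ t; for t ≥ 2 one of the two copies covers the next surplus.
  dim-lower : ∀ {m t} → 2 ≤ t → 4 + t ≤ m → 4 + 2 ^ t ≤ dim m
  dim-lower {t = t} 2≤t (s≤s (s≤s (s≤s (s≤s {n = m} t≤m)))) = begin
    4 + 2 ^ t          ≤⟨ +-monoˡ-≤ (2 ^ t) (^-monoʳ-≤ 2 2≤t) ⟩
    2 ^ t + 2 ^ t      ≡⟨ 2^suc t ⟨
    2 ^ suc t          ≤⟨ ^-monoʳ-≤ 2 (s≤s t≤m) ⟩
    2 ^ suc m          ≤⟨ n≤1+n _ ⟩
    suc (2 ^ suc m)    ∎
    where open ≤-Reasoning

  2≤twr : ∀ i → 2 ≤ twr (suc i)
  2≤twr zero    = ≤-refl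
  2≤twr (suc i) = ^-monoʳ-≤ 2 {1} (≤-trans (s≤s z≤n) (2≤twr i))

  D-lower : ∀ i → 4 + twr (2 + i) ≤ D (3 + i)
  -- Both sides are 8, since `D` starts 0, 1, 3, 8.
  D-lower zero    = ≤-refl
  D-lower (suc i) = ≤-trans (dim-lower (2≤twr (suc i)) (D-lower i)) (m≤n+m _ (D (3 + i)))

  twr≤D : ∀ i → twr i ≤ D (suc i)
  twr≤D zero          = ≤-refl
  twr≤D (suc zero)    = n≤1+n 2
  twr≤D (suc (suc i)) = ≤-trans (m≤n+m _ 4) (D-lower i)

module Regularity where

  open Codes
  open import Data.Nat using (_≤′_; ≤′-refl; ≤′-step)
  open ℚ
  open ℚₚ

  -- Natural numbers inside the rationals.

  ⌜_⌝ : ℕ → ℚ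
  ⌜ k ⌝ = ℤ.+ k / 1

  private
    ⌜⌝ᵘ : ∀ k → toℚᵘ ⌜ k ⌝ ℚᵘ.≃ ℚᵘ.mkℚᵘ (ℤ.+ k) 0
    ⌜⌝ᵘ k = toℚᵘ-fromℚᵘ (ℚᵘ.mkℚᵘ (ℤ.+ k) 0)

  ⌜⌝-+ : ∀ a b → ⌜ a ℕ.+ b ⌝ ≡ ⌜ a ⌝ + ⌜ b ⌝
  ⌜⌝-+ a b = toℚᵘ-injective (begin
    toℚᵘ ⌜ a ℕ.+ b ⌝                              ≈⟨ ⌜⌝ᵘ (a ℕ.+ b) ⟩
    ℚᵘ.mkℚᵘ (ℤ.+ (a ℕ.+ b)) 0
      ≈⟨ ℚᵘ.*≡* (cong (ℤ._* ℤ.+ 1)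
          (trans (ℤₚ.pos-+ a b)
          (sym (cong₂ ℤ._+_ (ℤₚ.*-identityʳ (ℤ.+ a)) (ℤₚ.*-identityʳ (ℤ.+ b)))))) ⟩
    ℚᵘ.mkℚᵘ (ℤ.+ a) 0 ℚᵘ.+ ℚᵘ.mkℚᵘ (ℤ.+ b) 0      ≈⟨ ℚᵘₚ.+-cong (⌜⌝ᵘ a) (⌜⌝ᵘ b) ⟨
    toℚᵘ ⌜ a ⌝ ℚᵘ.+ toℚᵘ ⌜ b ⌝                    ≈⟨ toℚᵘ-homo-+ ⌜ a ⌝ ⌜ b ⌝ ⟨
    toℚᵘ (⌜ a ⌝ + ⌜ b ⌝)                          ∎)
    where open ℚᵘₚ.≃-Reasoning

  ⌜⌝-* : ∀ a b → ⌜ a ℕ.* b ⌝ ≡ ⌜ a ⌝ * ⌜ b ⌝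
  ⌜⌝-* a b = toℚᵘ-injective (begin
    toℚᵘ ⌜ a ℕ.* b ⌝                              ≈⟨ ⌜⌝ᵘ (a ℕ.* b) ⟩
    ℚᵘ.mkℚᵘ (ℤ.+ (a ℕ.* b)) 0                     ≈⟨ ℚᵘ.*≡* (cong (ℤ._* ℤ.+ 1) (ℤₚ.pos-* a b)) ⟩
    ℚᵘ.mkℚᵘ (ℤ.+ a) 0 ℚᵘ.* ℚᵘ.mkℚᵘ (ℤ.+ b) 0      ≈⟨ ℚᵘₚ.*-cong (⌜⌝ᵘ a) (⌜⌝ᵘ b) ⟨
    toℚᵘ ⌜ a ⌝ ℚᵘ.* toℚᵘ ⌜ b ⌝                    ≈⟨ toℚᵘ-homo-* ⌜ a ⌝ ⌜ b ⌝ ⟨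
    toℚᵘ (⌜ a ⌝ * ⌜ b ⌝)                          ∎)
    where open ℚᵘₚ.≃-Reasoning

  *-÷ℕ-cancel : ∀ a b → ⌜ suc b ⌝ * (a ÷ℕ suc b) ≡ ⌜ a ⌝
  *-÷ℕ-cancel a b = toℚᵘ-injective (begin
    toℚᵘ (⌜ suc b ⌝ * (a ÷ℕ suc b))               ≈⟨ toℚᵘ-homo-* ⌜ suc b ⌝ (a ÷ℕ suc b) ⟩
    toℚᵘ ⌜ suc b ⌝ ℚᵘ.* toℚᵘ (a ÷ℕ suc b)
      ≈⟨ ℚᵘₚ.*-cong (⌜⌝ᵘ (suc b)) (toℚᵘ-fromℚᵘ (ℚᵘ.mkℚᵘ (ℤ.+ a) b)) ⟩
    ℚᵘ.mkℚᵘ (ℤ.+ suc b) 0 ℚᵘ.* ℚᵘ.mkℚᵘ (ℤ.+ a) b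
      ≈⟨ ℚᵘ.*≡* (trans (ℤₚ.*-identityʳ _)
          (trans (ℤₚ.*-comm (ℤ.+ suc b) (ℤ.+ a))
          (cong (λ c → ℤ.+ a ℤ.* ℤ.+ suc c) (sym (ℕₚ.+-identityʳ b))))) ⟩
    ℚᵘ.mkℚᵘ (ℤ.+ a) 0                             ≈⟨ ⌜⌝ᵘ a ⟨
    toℚᵘ ⌜ a ⌝                                    ∎)
    where open ℚᵘₚ.≃-Reasoning

  ⌜⌝-mono : ∀ {a b} → a ℕ.≤ b → ⌜ a ⌝ ≤ ⌜ b ⌝
  ⌜⌝-mono {a} {b} a≤b = toℚᵘ-cancel-≤ (begin
    toℚᵘ ⌜ a ⌝          ≃⟨ ⌜⌝ᵘ a ⟩
    ℚᵘ.mkℚᵘ (ℤ.+ a) 0   ≤⟨ ℚᵘ.*≤* (ℤₚ.*-monoʳ-≤-nonNeg (ℤ.+ 1) (ℤ.+≤+ a≤b)) ⟩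
    ℚᵘ.mkℚᵘ (ℤ.+ b) 0   ≃⟨ ⌜⌝ᵘ b ⟨
    toℚᵘ ⌜ b ⌝          ∎)
    where open ℚᵘₚ.≤-Reasoning

  ⌜suc⌝-positive : ∀ k → Positive ⌜ suc k ⌝
  ⌜suc⌝-positive k = normalize-pos (suc k) 1

  2^-positive : ∀ n → Positive ⌜ 2 ℕ.^ n ⌝
  2^-positive n = normalize-pos (2 ℕ.^ n) 1 {{_}} {{ℕₚ.m^n≢0 2 n}}

  p≤∣p∣ : ∀ p → p ≤ ∣ p ∣
  p≤∣p∣ p with ∣p∣≡p∨∣p∣≡-p p
  ... | inj₁ eq = ≤-reflexive (sym eq)
  ... | inj₂ eq = ≤-trans
      (≤-trans (≤-reflexive (trans (solve 1 (λ p → p := :- (:- p)) refl p) (cong -_ (sym eq))))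
      (neg-antimono-≤ (0≤∣p∣ p))) (0≤∣p∣ p)
    where open ℚ-Solver

  -p≤∣p∣ : ∀ p → - p ≤ ∣ p ∣
  -p≤∣p∣ p = ≤-trans (p≤∣p∣ (- p)) (≤-reflexive (∣-p∣≡∣p∣ p))

  *-monoˡ-≤ : ∀ {r p q} → 0ℚ ≤ r → p ≤ q → r * p ≤ r * q
  *-monoˡ-≤ {r} 0≤r p≤q = *-monoˡ-≤-nonNeg r {{nonNegative 0≤r}} p≤q

  -- Indicators and uniform averages over 𝔽₂ⁿ.

  bit : Bool → ℚ
  bit true  = 1ℚ
  bit false = 0ℚ

  0≤bit : ∀ b → 0ℚ ≤ bit b
  0≤bit true  = ≤ᵇ⇒≤ _
  0≤bit false = ≤-refl

  bit≤1 : ∀ b → bit b ≤ 1ℚ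
  bit≤1 true  = ≤-refl
  bit≤1 false = ≤ᵇ⇒≤ _

  -- Recursion on the coordinates spares a division by 2 ^ n and makes translation, exchange of
  -- averages and splitting into blocks plain inductions; `sumℚ-𝔼` links it to sums.
  𝔼 : ∀ {n} → (𝔽₂^ n → ℚ) → ℚ
  𝔼 {zero}  φ = φ []
  𝔼 {suc n} φ = ½ * (𝔼 (φ ∘ (false ∷_)) + 𝔼 (φ ∘ (true ∷_)))

  𝔼-cong : ∀ {n} {φ ψ : 𝔽₂^ n → ℚ} → (∀ x → φ x ≡ ψ x) → 𝔼 φ ≡ 𝔼 ψ
  𝔼-cong {zero}  eq = eq []
  𝔼-cong {suc n} eq = cong (½ *_) (cong₂ _+_ (𝔼-cong (eq ∘ (false ∷_))) (𝔼-cong (eq ∘ (true ∷_))))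

  𝔼-mono : ∀ {n} {φ ψ : 𝔽₂^ n → ℚ} → (∀ x → φ x ≤ ψ x) → 𝔼 φ ≤ 𝔼 ψ
  𝔼-mono {zero}  le = le []
  𝔼-mono {suc n} le = *-monoˡ-≤-nonNeg ½
      (+-mono-≤ (𝔼-mono (le ∘ (false ∷_))) (𝔼-mono (le ∘ (true ∷_))))

  𝔼-+ : ∀ {n} (φ ψ : 𝔽₂^ n → ℚ) → 𝔼 (λ x → φ x + ψ x) ≡ 𝔼 φ + 𝔼 ψ
  𝔼-+ {zero}  φ ψ = refl
  𝔼-+ {suc n} φ ψ rewrite 𝔼-+ (φ ∘ (false ∷_)) (ψ ∘ (false ∷_))
                        | 𝔼-+ (φ ∘ (true ∷_)) (ψ ∘ (true ∷_)) =
    solve 5 (λ h a b c d → h :* ((a :+ b) :+ (c :+ d)) := h :* (a :+ c) :+ h :* (b :+ d)) refl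
      ½ (𝔼 (φ ∘ (false ∷_))) _ (𝔼 (φ ∘ (true ∷_))) _
    where open ℚ-Solver

  𝔼-* : ∀ {n} c (φ : 𝔽₂^ n → ℚ) → 𝔼 (λ x → c * φ x) ≡ c * 𝔼 φ
  𝔼-* {zero}  c φ = refl
  𝔼-* {suc n} c φ rewrite 𝔼-* c (φ ∘ (false ∷_)) | 𝔼-* c (φ ∘ (true ∷_)) =
    solve 4 (λ h c a b → h :* (c :* a :+ c :* b) := c :* (h :* (a :+ b))) refl
      ½ c (𝔼 (φ ∘ (false ∷_))) _
    where open ℚ-Solver

  𝔼-const : ∀ n c → 𝔼 {n} (λ _ → c) ≡ c
  𝔼-const zero    c = refl
  𝔼-const (suc n) c rewrite 𝔼-const n c = solve 1 (λ c → con ½ :* (c :+ c) := c) refl c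
    where open ℚ-Solver

  𝔼-affine : ∀ {n} a c (φ : 𝔽₂^ n → ℚ) → 𝔼 (λ x → a + c * φ x) ≡ a + c * 𝔼 φ
  𝔼-affine {n} a c φ = trans (𝔼-+ (λ _ → a) (λ x → c * φ x)) (cong₂ _+_ (𝔼-const n a) (𝔼-* c φ))

  𝔼-swap : ∀ {m n} (φ : 𝔽₂^ m → 𝔽₂^ n → ℚ) → 𝔼 (λ x → 𝔼 (φ x)) ≡ 𝔼 (λ y → 𝔼 (λ x → φ x y))
  𝔼-swap {zero}  φ = refl
  𝔼-swap {suc m} φ = trans
    (cong (½ *_) (trans (cong₂ _+_ (𝔼-swap (φ ∘ (false ∷_))) (𝔼-swap (φ ∘ (true ∷_))))
        (sym (𝔼-+ (λ y → 𝔼 (λ x → φ (false ∷ x) y)) _))))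
    (sym (𝔼-* ½ (λ y → 𝔼 (λ x → φ (false ∷ x) y) + 𝔼 (λ x → φ (true ∷ x) y))))

  𝔼-++ : ∀ m {n} (φ : 𝔽₂^ (m ℕ.+ n) → ℚ) → 𝔼 φ ≡ 𝔼 {m} (λ a → 𝔼 (λ b → φ (a ++ b)))
  𝔼-++ zero    φ = refl
  𝔼-++ (suc m) φ = cong (½ *_) (cong₂ _+_ (𝔼-++ m (φ ∘ (false ∷_))) (𝔼-++ m (φ ∘ (true ∷_))))

  𝔼-translate : ∀ {n} (g : 𝔽₂^ n) (φ : 𝔽₂^ n → ℚ) → 𝔼 (λ x → φ (g ⊕ x)) ≡ 𝔼 φ
  𝔼-translate []          φ = refl
  𝔼-translate (false ∷ g) φ = cong (½ *_)
      (cong₂ _+_ (𝔼-translate g (φ ∘ (false ∷_))) (𝔼-translate g (φ ∘ (true ∷_))))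
  𝔼-translate (true ∷ g)  φ = cong (½ *_)
      (trans (cong₂ _+_ (𝔼-translate g (φ ∘ (true ∷_))) (𝔼-translate g (φ ∘ (false ∷_))))
      (+-comm (𝔼 (φ ∘ (true ∷_))) _))

  private
    2^suc-½ : ∀ n a b → ⌜ 2 ℕ.^ n ⌝ * a + ⌜ 2 ℕ.^ n ⌝ * b ≡ ⌜ 2 ℕ.^ suc n ⌝ * (½ * (a + b))
    2^suc-½ n a b rewrite 2^suc n | ⌜⌝-+ (2 ℕ.^ n) (2 ℕ.^ n) =
      solve 3 (λ p a b → p :* a :+ p :* b := (p :+ p) :* (con ½ :* (a :+ b))) refl ⌜ 2 ℕ.^ n ⌝ a b
      where open ℚ-Solver

  sumℚ-++ : ∀ {A : Set} (φ : A → ℚ) xs ys → sumℚ φ (xs List.++ ys) ≡ sumℚ φ xs + sumℚ φ ys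
  sumℚ-++ φ []       ys = sym (+-identityˡ _)
  sumℚ-++ φ (x ∷ xs) ys = trans (cong (φ x +_) (sumℚ-++ φ xs ys)) (sym (+-assoc (φ x) _ _))

  sumℚ-map : ∀ {A B : Set} (φ : B → ℚ) (h : A → B) xs → sumℚ φ (List.map h xs) ≡ sumℚ (φ ∘ h) xs
  sumℚ-map φ h []       = refl
  sumℚ-map φ h (x ∷ xs) = cong (φ (h x) +_) (sumℚ-map φ h xs)

  sumℚ-𝔼 : ∀ {n} (φ : 𝔽₂^ n → ℚ) → sumℚ φ (allVecs n) ≡ ⌜ 2 ℕ.^ n ⌝ * 𝔼 φ
  sumℚ-𝔼 {zero}  φ = trans (+-identityʳ (φ [])) (sym (*-identityˡ (φ [])))
  sumℚ-𝔼 {suc n} φ = trans (sumℚ-++ φ (List.map (false ∷_) (allVecs n)) _) (trans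
    (cong₂ _+_ (trans (sumℚ-map φ _ (allVecs n)) (sumℚ-𝔼 (φ ∘ (false ∷_))))
        (trans (sumℚ-map φ _ (allVecs n)) (sumℚ-𝔼 (φ ∘ (true ∷_)))))
    (2^suc-½ n (𝔼 (φ ∘ (false ∷_))) (𝔼 (φ ∘ (true ∷_)))))

  #-𝔼 : ∀ {n} (p : 𝔽₂^ n → Bool) → ⌜ # p ⌝ ≡ ⌜ 2 ℕ.^ n ⌝ * 𝔼 (bit ∘ p)
  #-𝔼 {zero} p with p []
  ... | true  = refl
  ... | false = refl
  #-𝔼 {suc n} p = trans (cong ⌜_⌝ (#-suc p)) (trans (⌜⌝-+ (# (p ∘ (false ∷_))) _) (trans
    (cong₂ _+_ (#-𝔼 (p ∘ (false ∷_))) (#-𝔼 (p ∘ (true ∷_))))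
    (2^suc-½ n (𝔼 (bit ∘ p ∘ (false ∷_))) (𝔼 (bit ∘ p ∘ (true ∷_))))))

  -- Where ξ has a `true` entry, flipping that bit of b complements the inner product, so the two
  -- halves of the space average to ½.
  𝔼-bit-inner : ∀ {n} {ξ : 𝔽₂^ n} → NonZeroVec ξ → 𝔼 (λ b → bit ⟨ b , ξ ⟩) ≡ ½
  𝔼-bit-inner {ξ = true ∷ ξ} _ =
    trans (cong (λ t → ½ * (𝔼 (λ b → bit ⟨ b , ξ ⟩) + t))
            (trans (𝔼-cong (λ b → flip ⟨ b , ξ ⟩)) (𝔼-affine 1ℚ (- 1ℚ) (λ b → bit ⟨ b , ξ ⟩))))
      (solve 1 (λ a → con ½ :* (a :+ (con 1ℚ :+ con (- 1ℚ) :* a)) := con ½) refl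
          (𝔼 (λ b → bit ⟨ b , ξ ⟩)))
    where
    open ℚ-Solver
    flip : ∀ t → bit (not t) ≡ 1ℚ + (- 1ℚ) * bit t
    flip true  = refl
    flip false = refl
  𝔼-bit-inner {ξ = false ∷ ξ} (there nz) rewrite 𝔼-bit-inner nz = refl

  -- Vector addition, and the order and index of a subspace.

  ⊕-cancelˡ : ∀ {n} (x y : 𝔽₂^ n) → x ⊕ (x ⊕ y) ≡ y
  ⊕-cancelˡ []      []      = refl
  ⊕-cancelˡ (a ∷ x) (b ∷ y) = cong₂ _∷_ (trans (sym (xor-assoc a a b)) (cong (_xor b) (xor-same a)))
      (⊕-cancelˡ x y)

  ⊕-comm : ∀ {n} (x y : 𝔽₂^ n) → x ⊕ y ≡ y ⊕ x
  ⊕-comm []      []      = refl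
  ⊕-comm (a ∷ x) (b ∷ y) = cong₂ _∷_ (xor-comm a b) (⊕-comm x y)

  ⊕≡𝟎⇒≡ : ∀ {n} (x y : 𝔽₂^ n) → x ⊕ y ≡ 𝟎 → x ≡ y
  ⊕≡𝟎⇒≡ []          []          _  = refl
  ⊕≡𝟎⇒≡ (true ∷ x)  (true ∷ y)  eq = cong (true ∷_) (⊕≡𝟎⇒≡ x y (cong Vec.tail eq))
  ⊕≡𝟎⇒≡ (false ∷ x) (false ∷ y) eq = cong (false ∷_) (⊕≡𝟎⇒≡ x y (cong Vec.tail eq))

  #-cong : ∀ {n} {p q : 𝔽₂^ n → Bool} → (∀ x → p x ≡ q x) → # p ≡ # q
  #-cong {n} {p} {q} eq = go (allVecs n)
    where
    go : ∀ xs → count p xs ≡ count q xs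
    go []       = refl
    go (x ∷ xs) rewrite eq x = cong (λ c → if q x then suc c else c) (go xs)

  #-translate : ∀ {n} (g : 𝔽₂^ n) (p : 𝔽₂^ n → Bool) → # (λ x → p (g ⊕ x)) ≡ # p
  #-translate []          p = refl
  #-translate (false ∷ g) p = trans (#-suc (λ x → p ((false ∷ g) ⊕ x))) (trans
    (cong₂ ℕ._+_ (#-translate g (p ∘ (false ∷_))) (#-translate g (p ∘ (true ∷_)))) (sym (#-suc p)))
  #-translate (true ∷ g)  p = trans (#-suc (λ x → p ((true ∷ g) ⊕ x))) (trans
    (cong₂ ℕ._+_ (#-translate g (p ∘ (true ∷_))) (#-translate g (p ∘ (false ∷_))))
    (trans (ℕₚ.+-comm (# (p ∘ (true ∷_))) _) (sym (#-suc p))))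

  search : ∀ {n} (p : 𝔽₂^ n → Bool) → (∃ λ x → T (p x)) ⊎ (# p ≡ 0)
  search {zero} p with p [] in eq
  ... | true  = inj₁ ([] , subst T (sym eq) _)
  ... | false = inj₂ refl
  search {suc n} p with search (p ∘ (false ∷_)) | search (p ∘ (true ∷_))
  ... | inj₁ (x , t) | _            = inj₁ (false ∷ x , t)
  ... | inj₂ _       | inj₁ (x , t) = inj₁ (true ∷ x , t)
  ... | inj₂ e₀      | inj₂ e₁      = inj₂ (trans (#-suc p) (cong₂ ℕ._+_ e₀ e₁))

  T-ext : ∀ {a b} → (T a → T b) → (T b → T a) → a ≡ b
  T-ext {true}  {true}  _ _ = refl
  T-ext {false} {false} _ _ = refl
  T-ext {true}  {false} f _ = ⊥-elim (f _)
  T-ext {false} {true}  _ g = ⊥-elim (g _)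

  tailSubspace : ∀ {n} → Subspace (suc n) → Subspace n
  tailSubspace H .mem x           = mem H (false ∷ x)
  tailSubspace H .has-𝟎           = has-𝟎 H
  tailSubspace H .closed⊕ x y p q = closed⊕ H (false ∷ x) (false ∷ y) p q

  -- Either all of H has first coordinate `false`, which doubles the quotient, or H contains some
  -- `true ∷ x₀`, and translation by it matches the two halves of H.
  card-∣-2^ : ∀ {n} (H : Subspace n) → ∃ λ k → k ℕ.* card H ≡ 2 ℕ.^ n
  card-∣-2^ {zero} H with mem H [] | has-𝟎 H
  ... | true | _ = 1 , refl
  card-∣-2^ {suc n} H with card-∣-2^ (tailSubspace H) | search (mem H ∘ (true ∷_))
  ... | k , eq | inj₂ e = 2 ℕ.* k , trans
    (cong (2 ℕ.* k ℕ.*_)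
        (trans (#-suc (mem H)) (trans (cong (card (tailSubspace H) ℕ.+_) e) (ℕₚ.+-identityʳ _))))
    (trans (ℕₚ.*-assoc 2 k _) (cong (2 ℕ.*_) eq))
  ... | k , eq | inj₁ (x₀ , x₀∈H) = k , (begin
    k ℕ.* card H
      ≡⟨ cong (k ℕ.*_) (trans (#-suc (mem H)) (cong (card (tailSubspace H) ℕ.+_) coset)) ⟩
    k ℕ.* (card (tailSubspace H) ℕ.+ card (tailSubspace H))
      ≡⟨ ℕₚ.*-distribˡ-+ k (card (tailSubspace H)) _ ⟩
    k ℕ.* card (tailSubspace H) ℕ.+ k ℕ.* card (tailSubspace H) ≡⟨ cong₂ ℕ._+_ eq eq ⟩
    2 ℕ.^ n ℕ.+ 2 ℕ.^ n                                   ≡⟨ 2^suc n ⟨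
    2 ℕ.^ suc n                                           ∎)
    where
    open ≡-Reasoning
    coset : # (mem H ∘ (true ∷_)) ≡ card (tailSubspace H)
    coset = trans
      (#-cong λ x → T-ext (closed⊕ H (true ∷ x₀) (true ∷ x) x₀∈H)
        (λ t → subst (λ v → T (mem H (true ∷ v))) (⊕-cancelˡ x₀ x)
            (closed⊕ H (true ∷ x₀) (false ∷ (x₀ ⊕ x)) x₀∈H t)))
      (#-translate x₀ (mem H ∘ (false ∷_)))

  card-suc : ∀ {n} (H : Subspace n) → ∃ λ c → card H ≡ suc c
  card-suc H with card H in eq
  ... | suc c = c , refl
  ... | zero  = ⊥-elim (subst T (#-zero (mem H) eq 𝟎) (has-𝟎 H))

  -- Divisibility makes the truncated division in `index` exact.
  index-card : ∀ {n} (H : Subspace n) → index H ℕ.* card H ≡ 2 ℕ.^ n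
  index-card {n} H with card H | card-suc H | card-∣-2^ H
  ... | suc c | _ | k , eq = trans
      (cong (ℕ._* suc c) (trans (cong (ℕ._/ suc c) (sym eq)) (ℕ.m*n/n≡m k (suc c)))) eq

  -- Fourier coefficients averaged over the translates of a regular subspace.

  -- The frequency η may vary with the coset of H: averaging over all translates of H still turns the
  -- correlation of f with x ↦ (-1)^⟨x, η x⟩ on κ into an average of Fourier coefficients.
  module _ {n} (H : Subspace n) (f : 𝔽₂^ n → ℚ) (f∈[0,1] : ∀ x → 0ℚ ≤ f x × f x ≤ 1ℚ)
           {ε} (regular : IsRegularSubspace ε f H)
           (η : 𝔽₂^ n → 𝔽₂^ n) (κ : 𝔽₂^ n → Bool)
           (η-coset : ∀ x g → T (mem H (x ⊕ g)) → η x ≡ η g)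
           (κ-coset : ∀ x g → T (mem H (x ⊕ g)) → κ x ≡ κ g)
           (κ⇒nontrivial : ∀ g → κ g ≡ true → ¬ T (inPerp H (η g))) where

    open IsRegularSubspace regular
    open ℚ-Solver

    private
      P δ ρ : ℚ
      P = ⌜ 2 ℕ.^ n ⌝
      δ = 𝔼 (bit ∘ mem H)
      ρ = 𝔼 (bit ∘ good)

      φ : 𝔽₂^ n → ℚ
      φ x = f x * (bit (κ x) * sign ⟨ x , η x ⟩)

      -- This is δ times the mean of φ over the translate of H by g. Letting g range over all points
      -- counts each translate equally often.
      W : 𝔽₂^ n → ℚ
      W g = 𝔼 (λ x → bit (mem H (x ⊕ g)) * φ x)

      *-÷ℕ-card : ∀ a → ⌜ card H ⌝ * (a ÷ℕ card H) ≡ ⌜ a ⌝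
      *-÷ℕ-card a with card H | card-suc H
      ... | suc c | _ = *-÷ℕ-cancel a c

      card-positive : Positive ⌜ card H ⌝
      card-positive with card H | card-suc H
      ... | suc c | _ = ⌜suc⌝-positive c

      instance
        P⁺ : Positive P
        P⁺ = 2^-positive n
        card⁺ : Positive ⌜ card H ⌝
        card⁺ = card-positive

      δ>0 : 0ℚ < δ
      δ>0 = *-cancelˡ-<-nonNeg P {{pos⇒nonNeg P}} (begin-strict
        P * 0ℚ      ≡⟨ *-zeroʳ P ⟩
        0ℚ          <⟨ positive⁻¹ ⌜ card H ⌝ ⟩
        ⌜ card H ⌝  ≡⟨ #-𝔼 (mem H) ⟩
        P * δ       ∎)
        where open ≤-Reasoning

      instance
        δ⁺ : Positive δ
        δ⁺ = positive δ>0

      fourier-𝔼 : ∀ g ζ → 𝔼 (λ x → if inTranslate H g x then f x * sign ⟨ x , ζ ⟩ else 0ℚ)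
          ≡ δ * fourier f H g ζ
      fourier-𝔼 g ζ = sym (begin
        δ * ((1 ÷ℕ card H) * sumℚ ψ (allVecs n))
          ≡⟨ cong (λ t → δ * ((1 ÷ℕ card H) * t)) (sumℚ-𝔼 ψ) ⟩
        δ * ((1 ÷ℕ card H) * (P * 𝔼 ψ))
          ≡⟨ solve 4 (λ d c p e → d :* (c :* (p :* e)) := ((p :* d) :* c) :* e) refl δ
              (1 ÷ℕ card H) P (𝔼 ψ) ⟩
        ((P * δ) * (1 ÷ℕ card H)) * 𝔼 ψ
          ≡⟨ cong (λ t → (t * (1 ÷ℕ card H)) * 𝔼 ψ) (#-𝔼 (mem H)) ⟨
        (⌜ card H ⌝ * (1 ÷ℕ card H)) * 𝔼 ψ         ≡⟨ cong (_* 𝔼 ψ) (*-÷ℕ-card 1) ⟩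
        1ℚ * 𝔼 ψ                                   ≡⟨ *-identityˡ (𝔼 ψ) ⟩
        𝔼 ψ                                        ∎)
        where
        open ≡-Reasoning
        ψ : 𝔽₂^ n → ℚ
        ψ x = if inTranslate H g x then f x * sign ⟨ x , ζ ⟩ else 0ℚ

      -- Multiplying `many` by |H| turns the share of regular translates into the share of points g
      -- that lie in them, because index times order is 2 ^ n.
      1-ε≤ρ : 1ℚ - ε ≤ ρ
      1-ε≤ρ = *-cancelˡ-≤-pos P (begin
        P * (1ℚ - ε)
          ≡⟨ cong (λ t → ⌜ t ⌝ * (1ℚ - ε)) (index-card H) ⟨
        ⌜ index H ℕ.* card H ⌝ * (1ℚ - ε)
          ≡⟨ cong (_* (1ℚ - ε)) (⌜⌝-* (index H) (card H)) ⟩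
        (⌜ index H ⌝ * ⌜ card H ⌝) * (1ℚ - ε)
          ≡⟨ solve 3 (λ i c e → (i :* c) :* e := c :* (e :* i)) refl ⌜ index H ⌝ ⌜ card H ⌝
              (1ℚ - ε) ⟩
        ⌜ card H ⌝ * ((1ℚ - ε) * ⌜ index H ⌝)
          ≤⟨ *-monoˡ-≤-nonNeg ⌜ card H ⌝ {{pos⇒nonNeg ⌜ card H ⌝}} many ⟩
        ⌜ card H ⌝ * (# good ÷ℕ card H)                 ≡⟨ *-÷ℕ-card (# good) ⟩
        ⌜ # good ⌝                                      ≡⟨ #-𝔼 good ⟩
        P * ρ                                           ∎)
        where open ≤-Reasoning

      -φ≤1 : ∀ x → - φ x ≤ 1ℚ
      -φ≤1 x with f∈[0,1] x | κ x | ⟨ x , η x ⟩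
      ... | 0≤f , f≤1 | true  | true  = ≤-trans
          (≤-reflexive (solve 1 (λ f → :- (f :* con (- 1ℚ)) := f) refl (f x))) f≤1
      ... | 0≤f , f≤1 | true  | false = ≤-trans
          (≤-reflexive (solve 1 (λ f → :- (f :* con 1ℚ) := :- f) refl (f x)))
          (≤-trans (neg-antimono-≤ 0≤f) (≤ᵇ⇒≤ _))
      ... | 0≤f , f≤1 | false | true  = ≤-trans
          (≤-reflexive (solve 1 (λ f → :- (f :* con 0ℚ) := con 0ℚ) refl (f x))) (≤ᵇ⇒≤ _)
      ... | 0≤f , f≤1 | false | false = ≤-trans
          (≤-reflexive (solve 1 (λ f → :- (f :* con 0ℚ) := con 0ℚ) refl (f x))) (≤ᵇ⇒≤ _)

      𝔼-neg : (ψ : 𝔽₂^ n → ℚ) → - 𝔼 ψ ≡ 𝔼 (λ x → - ψ x)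
      𝔼-neg ψ = trans (solve 1 (λ a → :- a := con (- 1ℚ) :* a) refl (𝔼 ψ))
        (trans (sym (𝔼-* (- 1ℚ) ψ))
            (𝔼-cong λ x → solve 1 (λ a → con (- 1ℚ) :* a := :- a) refl (ψ x)))

      coset-density : ∀ g → 𝔼 (λ x → bit (mem H (x ⊕ g))) ≡ δ
      coset-density g = trans (𝔼-cong λ x → cong (bit ∘ mem H) (⊕-comm x g))
          (𝔼-translate g (bit ∘ mem H))

      W-trivial-bound : ∀ g → - W g ≤ δ
      W-trivial-bound g = begin
        - W g                                      ≡⟨ 𝔼-neg _ ⟩
        𝔼 (λ x → - (bit (mem H (x ⊕ g)) * φ x))
          ≤⟨ 𝔼-mono (λ x → ≤-trans
              (≤-reflexive (solve 2 (λ b p → :- (b :* p) := b :* (:- p)) refl (bit (mem H (x ⊕ g)))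
              (φ x))) (≤-trans (*-monoˡ-≤ (0≤bit (mem H (x ⊕ g))) (-φ≤1 x))
              (≤-reflexive (*-identityʳ _)))) ⟩
        𝔼 (λ x → bit (mem H (x ⊕ g)))              ≡⟨ coset-density g ⟩
        δ                                          ∎
        where open ≤-Reasoning

      W-untested : ∀ g → κ g ≡ false → W g ≡ 0ℚ
      W-untested g κg = trans (𝔼-cong pointwise) (𝔼-const n 0ℚ)
        where
        pointwise : ∀ x → bit (mem H (x ⊕ g)) * φ x ≡ 0ℚ
        pointwise x with mem H (x ⊕ g) in eq
        ... | false = *-zeroˡ (φ x)
        ... | true rewrite κ-coset x g (subst T (sym eq) _) | κg =
          solve 2 (λ a b → con 1ℚ :* (a :* (con 0ℚ :* b)) := con 0ℚ) refl (f x) (sign ⟨ x , η x ⟩)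

      W-fourier : ∀ g → κ g ≡ true → W g ≡ δ * fourier f H g (η g)
      W-fourier g κg = trans (𝔼-cong pointwise) (fourier-𝔼 g (η g))
        where
        pointwise : ∀ x → bit (mem H (x ⊕ g)) * φ x
            ≡ (if mem H (x ⊕ g) then f x * sign ⟨ x , η g ⟩ else 0ℚ)
        pointwise x with mem H (x ⊕ g) in eq
        ... | false = *-zeroˡ (φ x)
        ... | true rewrite κ-coset x g (subst T (sym eq) _) | κg
                         | η-coset x g (subst T (sym eq) _) =
          solve 2 (λ a b → con 1ℚ :* (a :* (con 1ℚ :* b)) := a :* b) refl (f x) (sign ⟨ x , η g ⟩)

      -- Good translates give δ * ε and the others the trivial δ. Both are written as one affine
      -- expression in `bit (good g)`, whose average involves ρ alone.
      W-bound : 0ℚ ≤ ε → ∀ g → - W g ≤ δ * (1ℚ + (- (1ℚ - ε)) * bit (good g))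
      W-bound 0≤ε g with good g in goodg
      ... | false = ≤-trans (W-trivial-bound g)
          (≤-reflexive (solve 2
          (λ d e → d := d :* (con 1ℚ :+ (:- (con 1ℚ :- e)) :* con 0ℚ)) refl δ ε))
      ... | true  = ≤-trans (regular-bound (κ g) refl)
          (≤-reflexive (solve 2
          (λ d e → d :* e := d :* (con 1ℚ :+ (:- (con 1ℚ :- e)) :* con 1ℚ)) refl δ ε))
        where
        -- If κ g is false, the translate contributes 0; otherwise regularity applies at η g, which
        -- is outside the annihilator of H.
        regular-bound : ∀ b → κ g ≡ b → - W g ≤ δ * ε
        regular-bound false κg rewrite W-untested g κg =
          ≤-trans (≤-reflexive (sym (*-zeroʳ δ))) (*-monoˡ-≤ (<⇒≤ δ>0) 0≤ε)
        regular-bound true κg = begin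
          - W g                          ≡⟨ cong -_ (W-fourier g κg) ⟩
          - (δ * fourier f H g (η g))    ≡⟨ neg-distribʳ-* δ _ ⟩
          δ * - fourier f H g (η g)      ≤⟨ *-monoˡ-≤ (<⇒≤ δ>0) (-p≤∣p∣ (fourier f H g (η g))) ⟩
          δ * ∣ fourier f H g (η g) ∣
            ≤⟨ *-monoˡ-≤ (<⇒≤ δ>0)
                (good-spec₁ g (subst T (sym goodg) _) (η g) (κ⇒nontrivial g κg)) ⟩
          δ * ε                          ∎
          where open ≤-Reasoning

      -- After exchanging the averages, for each x the points g in its coset have density δ.
      𝔼-W : 𝔼 W ≡ δ * 𝔼 φ
      𝔼-W = begin
        𝔼 (λ g → 𝔼 (λ x → bit (mem H (x ⊕ g)) * φ x))
          ≡⟨ 𝔼-swap (λ g x → bit (mem H (x ⊕ g)) * φ x) ⟩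
        𝔼 (λ x → 𝔼 (λ g → bit (mem H (x ⊕ g)) * φ x))
          ≡⟨ 𝔼-cong (λ x → trans (𝔼-cong λ g → *-comm (bit (mem H (x ⊕ g))) (φ x))
              (trans (𝔼-* (φ x) (λ g → bit (mem H (x ⊕ g))))
              (cong (φ x *_) (𝔼-translate x (bit ∘ mem H))))) ⟩
        𝔼 (λ x → φ x * δ)
          ≡⟨ trans (𝔼-cong λ x → *-comm (φ x) δ) (𝔼-* δ φ) ⟩
        δ * 𝔼 φ                                         ∎
        where open ≡-Reasoning

    -- Averaging `W-bound` over g gives δ(1 - (1 - ε)ρ); then ρ ≥ 1 - ε, and the factor δ cancels.
    correlation-upper : 0ℚ ≤ ε → 0ℚ ≤ 1ℚ - ε →
      - 𝔼 (λ x → f x * (bit (κ x) * sign ⟨ x , η x ⟩)) ≤ 1ℚ - (1ℚ - ε) * (1ℚ - ε)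
    correlation-upper 0≤ε 0≤1-ε = *-cancelˡ-≤-pos δ (begin
      δ * - 𝔼 φ                                              ≡⟨ neg-distribʳ-* δ (𝔼 φ) ⟨
      - (δ * 𝔼 φ)                                            ≡⟨ cong -_ 𝔼-W ⟨
      - 𝔼 W                                                  ≡⟨ 𝔼-neg W ⟩
      𝔼 (λ g → - W g)                                        ≤⟨ 𝔼-mono (W-bound 0≤ε) ⟩
      𝔼 (λ g → δ * (1ℚ + (- (1ℚ - ε)) * bit (good g)))
        ≡⟨ 𝔼-* δ (λ g → 1ℚ + (- (1ℚ - ε)) * bit (good g)) ⟩
      δ * 𝔼 (λ g → 1ℚ + (- (1ℚ - ε)) * bit (good g))
        ≡⟨ cong (δ *_) (𝔼-affine 1ℚ (- (1ℚ - ε)) (bit ∘ good)) ⟩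
      δ * (1ℚ + (- (1ℚ - ε)) * ρ)
        ≡⟨ cong (λ t → δ * (1ℚ + t)) (neg-distribˡ-* (1ℚ - ε) ρ) ⟨
      δ * (1ℚ - (1ℚ - ε) * ρ)
        ≤⟨ *-monoˡ-≤ (<⇒≤ δ>0) (+-monoʳ-≤ 1ℚ (neg-antimono-≤ (*-monoˡ-≤ 0≤1-ε 1-ε≤ρ))) ⟩
      δ * (1ℚ - (1ℚ - ε) * (1ℚ - ε))                         ∎)
      where open ≤-Reasoning

  -- Concatenated vectors, prefixes and the function `F`.

  inner-𝟎ʳ : ∀ {n} (x : 𝔽₂^ n) → ⟨ x , 𝟎 ⟩ ≡ false
  inner-𝟎ʳ []      = refl
  inner-𝟎ʳ (b ∷ x) rewrite ∧-zeroʳ b = inner-𝟎ʳ x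

  inner-𝟎++ : ∀ m {n} (x : 𝔽₂^ (m ℕ.+ n)) (η : 𝔽₂^ n) → ⟨ x , 𝟎 {m} ++ η ⟩ ≡ ⟨ drop m x , η ⟩
  inner-𝟎++ zero    x       η = refl
  inner-𝟎++ (suc m) (b ∷ x) η rewrite ∧-zeroʳ b = inner-𝟎++ m x η

  inner-++𝟎 : ∀ m {n} (x : 𝔽₂^ (m ℕ.+ n)) (η : 𝔽₂^ m) → ⟨ x , η ++ 𝟎 {n} ⟩ ≡ ⟨ take m x , η ⟩
  inner-++𝟎 zero    x       []      = inner-𝟎ʳ x
  inner-++𝟎 (suc m) (b ∷ x) (c ∷ η) = cong ((b ∧ c) xor_) (inner-++𝟎 m x η)

  take-++ : ∀ {m n} (a : 𝔽₂^ m) (b : 𝔽₂^ n) → take m (a ++ b) ≡ a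
  take-++ []      b = refl
  take-++ (x ∷ a) b = cong (x ∷_) (take-++ a b)

  drop-++ : ∀ {m n} (a : 𝔽₂^ m) (b : 𝔽₂^ n) → drop m (a ++ b) ≡ b
  drop-++ []      b = refl
  drop-++ (x ∷ a) b = drop-++ a b

  𝟎-++ : ∀ m {n} → 𝟎 {m} ++ 𝟎 {n} ≡ 𝟎
  𝟎-++ zero    = refl
  𝟎-++ (suc m) = cong (false ∷_) (𝟎-++ m)

  -- A point of 𝔽₂^ (D (suc i)) is a prefix in 𝔽₂^ (D i) followed by a block, which F tests
  -- against the column that the prefix selects.
  prefix : ∀ i → 𝔽₂^ (D (suc i)) → 𝔽₂^ (D i)
  prefix i = take (D i)

  block : ∀ i → 𝔽₂^ (D (suc i)) → 𝔽₂^ (dim (D i))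
  block i = drop (D i)

  column : ∀ i → 𝔽₂^ (D i) → 𝔽₂^ (dim (D i))
  column i = code (D i) .ξ

  F : ∀ s → 𝔽₂^ (D s) → ℚ
  F zero    _ = 0ℚ
  F (suc s) x = F s (prefix s x) + bit ⟨ block s x , column s (prefix s x) ⟩

  F-bounds : ∀ s x → 0ℚ ≤ F s x × F s x ≤ ⌜ s ⌝
  F-bounds zero    x = ≤-refl , ≤-refl
  F-bounds (suc s) x with F-bounds s (prefix s x)
  ... | 0≤F , F≤s =
    +-mono-≤ 0≤F (0≤bit b) ,
    ≤-trans (+-mono-≤ F≤s (bit≤1 b)) (≤-reflexive (trans (+-comm ⌜ s ⌝ 1ℚ) (sym (⌜⌝-+ 1 s))))
    where b = ⟨ block s x , column s (prefix s x) ⟩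

  proj : ∀ {i s} → i ≤′ s → 𝔽₂^ (D s) → 𝔽₂^ (D i)
  proj ≤′-refl             x = x
  proj (≤′-step {n = s} p) x = proj p (prefix s x)

  -- Zero padding, the adjoint of `proj` for the inner product.
  lift : ∀ {i s} → i ≤′ s → 𝔽₂^ (D i) → 𝔽₂^ (D s)
  lift ≤′-refl     η = η
  lift (≤′-step p) η = lift p η ++ 𝟎

  inner-lift : ∀ {i s} (p : i ≤′ s) x η → ⟨ x , lift p η ⟩ ≡ ⟨ proj p x , η ⟩
  inner-lift ≤′-refl             x η = refl
  inner-lift (≤′-step {n = s} p) x η = trans (inner-++𝟎 (D s) x (lift p η))
      (inner-lift p (prefix s x) η)

  proj-⊕ : ∀ {i s} (p : i ≤′ s) x y → proj p (x ⊕ y) ≡ proj p x ⊕ proj p y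
  proj-⊕ ≤′-refl             x y = refl
  proj-⊕ (≤′-step {n = s} p) x y = trans (cong (proj p) (take-zipWith _xor_ x y))
      (proj-⊕ p (prefix s x) (prefix s y))

  proj-marginal : ∀ {i s} (p : i ≤′ s) (u : 𝔽₂^ (D i) → ℚ) → 𝔼 (u ∘ proj p) ≡ 𝔼 u
  proj-marginal ≤′-refl             u = refl
  proj-marginal (≤′-step {n = s} p) u = begin
    𝔼 (λ x → u (proj p (prefix s x)))          ≡⟨ 𝔼-++ (D s) _ ⟩
    𝔼 {D s} (λ a → 𝔼 {dim (D s)} (λ b → u (proj p (prefix s (a ++ b)))))
      ≡⟨ 𝔼-cong (λ a → trans (𝔼-cong {dim (D s)} λ b → cong (u ∘ proj p) (take-++ a b))
          (𝔼-const (dim (D s)) (u (proj p a)))) ⟩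
    𝔼 (λ a → u (proj p a))                     ≡⟨ proj-marginal p u ⟩
    𝔼 u                                        ∎
    where open ≡-Reasoning

  -- This is (s - i)/2, as each of the s - i later blocks has mean ½.
  tailMean : ∀ {i s} → i ≤′ s → ℚ
  tailMean ≤′-refl     = 0ℚ
  tailMean (≤′-step p) = ½ + tailMean p

  -- Later blocks are equidistributed given the prefix, so they contribute a constant on average.
  F-pushforward : ∀ {i s} (p : i ≤′ s) (u : 𝔽₂^ (D i) → ℚ) →
    𝔼 (λ x → F s x * u (proj p x)) ≡ 𝔼 (λ y → (F i y + tailMean p) * u y)
  F-pushforward {i} ≤′-refl u = 𝔼-cong λ y → cong (_* u y) (sym (+-identityʳ (F i y)))
  F-pushforward {i} (≤′-step {n = s} p) u = begin
    𝔼 (λ x → F (suc s) x * u (proj p (prefix s x)))            ≡⟨ 𝔼-++ (D s) _ ⟩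
    𝔼 {D s} (λ a → 𝔼 {dim (D s)} (λ b → F (suc s) (a ++ b) * u (proj p (prefix s (a ++ b)))))
      ≡⟨ 𝔼-cong inner ⟩
    𝔼 (λ a → F s a * u (proj p a) + ½ * u (proj p a))
      ≡⟨ 𝔼-+ (λ a → F s a * u (proj p a)) (λ a → ½ * u (proj p a)) ⟩
    𝔼 (λ a → F s a * u (proj p a)) + 𝔼 (λ a → ½ * u (proj p a))
      ≡⟨ cong₂ _+_ (F-pushforward p u) (proj-marginal p (λ y → ½ * u y)) ⟩
    𝔼 (λ y → (F i y + tailMean p) * u y) + 𝔼 (λ y → ½ * u y)
      ≡⟨ 𝔼-+ (λ y → (F i y + tailMean p) * u y) (λ y → ½ * u y) ⟨
    𝔼 (λ y → (F i y + tailMean p) * u y + ½ * u y)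
      ≡⟨ 𝔼-cong (λ y → solve 3
          (λ f k u → (f :+ k) :* u :+ con ½ :* u := (f :+ (con ½ :+ k)) :* u) refl (F i y)
          (tailMean p) (u y)) ⟩
    𝔼 (λ y → (F i y + (½ + tailMean p)) * u y)                 ∎
    where
    open ≡-Reasoning
    open ℚ-Solver
    inner : ∀ a → 𝔼 {dim (D s)} (λ b → F (suc s) (a ++ b) * u (proj p (prefix s (a ++ b))))
        ≡ F s a * u (proj p a) + ½ * u (proj p a)
    inner a = begin
      𝔼 (λ b → F (suc s) (a ++ b) * u (proj p (prefix s (a ++ b))))
        ≡⟨ 𝔼-cong (λ b → cong₂ (λ a′ b′ → (F s a′ + bit ⟨ b′ , column s a′ ⟩) * u (proj p a′))
            (take-++ a b) (drop-++ a b)) ⟩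
      𝔼 (λ b → (F s a + bit ⟨ b , column s a ⟩) * u (proj p a))
        ≡⟨ 𝔼-cong (λ b → solve 3 (λ f t u → (f :+ t) :* u := f :* u :+ u :* t) refl (F s a)
            (bit ⟨ b , column s a ⟩) (u (proj p a))) ⟩
      𝔼 (λ b → F s a * u (proj p a) + u (proj p a) * bit ⟨ b , column s a ⟩)
        ≡⟨ 𝔼-affine (F s a * u (proj p a)) (u (proj p a)) (λ b → bit ⟨ b , column s a ⟩) ⟩
      F s a * u (proj p a) + u (proj p a) * 𝔼 (λ b → bit ⟨ b , column s a ⟩)
        ≡⟨ cong (λ t → F s a * u (proj p a) + t)
            (trans (cong (u (proj p a) *_) (𝔼-bit-inner (code (D s) .ξ-nonZero a)))
            (*-comm (u (proj p a)) ½)) ⟩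
      F s a * u (proj p a) + ½ * u (proj p a) ∎

  -- Correlation of `F` with the frequency selected by a prefix.

  ¼ : ℚ
  ¼ = ½ * ½

  code-density : ∀ m y → NonZeroVec y → ¼ ≤ 𝔼 (λ x → bit ⟨ y , code m .ξ x ⟩)
  code-density m y nz = *-cancelˡ-≤-pos (⌜ 4 ⌝ * P) {{pos*pos⇒pos ⌜ 4 ⌝ P {{2^-positive m}}}} (begin
    (⌜ 4 ⌝ * P) * ¼                ≡⟨ solve 1 (λ p → (con ⌜ 4 ⌝ :* p) :* con ¼ := p) refl P ⟩
    P                              ≤⟨ ⌜⌝-mono (code m .distance y nz) ⟩
    ⌜ 4 ℕ.* # q ⌝                  ≡⟨ ⌜⌝-* 4 (# q) ⟩
    ⌜ 4 ⌝ * ⌜ # q ⌝                ≡⟨ cong (⌜ 4 ⌝ *_) (#-𝔼 q) ⟩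
    ⌜ 4 ⌝ * (P * 𝔼 (bit ∘ q))      ≡⟨ *-assoc ⌜ 4 ⌝ P _ ⟨
    (⌜ 4 ⌝ * P) * 𝔼 (bit ∘ q)      ∎)
    where
    open ≤-Reasoning
    open ℚ-Solver
    P = ⌜ 2 ℕ.^ m ⌝
    q = λ x → ⟨ y , code m .ξ x ⟩

  module _ {i s} (p : suc i ≤′ s) (b : 𝔽₂^ (dim (D i))) where

    -- Zero outside block i, where it is the column selected by the prefix of x itself. Its inner
    -- product with x is therefore the very bit that `F` tests in that block.
    frequency : 𝔽₂^ (D s) → 𝔽₂^ (D s)
    frequency x = lift p (𝟎 ++ column i (prefix i (proj p x)))

    -- In use `b` is block i of some h in H. Then `tested x` is the inner product of h with
    -- `frequency x`, and its truth puts that frequency outside the annihilator of H.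
    tested : 𝔽₂^ (D s) → Bool
    tested x = ⟨ b , column i (prefix i (proj p x)) ⟩

    private
      u : 𝔽₂^ (D (suc i)) → ℚ
      u y = bit ⟨ b , column i (prefix i y) ⟩ * sign ⟨ block i y , column i (prefix i y) ⟩

      K = tailMean p

    -- Fix the prefix a and average over block i. The bit t tested there is uniform, and (X +
    -- t)(-1)^t averages to (X - (X + 1))/2 = -1/2 for any X, so the earlier terms and the mean K of
    -- the later ones cancel.
    correlation-F : 𝔼 (λ x → F s x * (bit (tested x) * sign ⟨ x , frequency x ⟩))
        ≡ - ½ * 𝔼 (λ a → bit ⟨ b , column i a ⟩)
    correlation-F = begin
      𝔼 (λ x → F s x * (bit (tested x) * sign ⟨ x , frequency x ⟩))
        ≡⟨ 𝔼-cong (λ x → cong (λ t → F s x * (bit (tested x) * sign t))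
            (trans (inner-lift p x _) (inner-𝟎++ (D i) (proj p x) _))) ⟩
      𝔼 (λ x → F s x * u (proj p x))
        ≡⟨ F-pushforward p u ⟩
      𝔼 (λ y → (F (suc i) y + K) * u y)
        ≡⟨ 𝔼-++ (D i) _ ⟩
      𝔼 {D i} (λ a → 𝔼 {dim (D i)} (λ c → (F (suc i) (a ++ c) + K) * u (a ++ c)))
        ≡⟨ 𝔼-cong inner ⟩
      𝔼 (λ a → - ½ * bit ⟨ b , column i a ⟩)
        ≡⟨ 𝔼-* (- ½) (λ a → bit ⟨ b , column i a ⟩) ⟩
      - ½ * 𝔼 (λ a → bit ⟨ b , column i a ⟩) ∎
      where
      open ≡-Reasoning
      open ℚ-Solver
      -- The product becomes affine in `bit t`, so only the mean of the bit is needed.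
      expand : ∀ x β t → (x + bit t) * (β * sign t) ≡ β * x + (- (β * (x + x + 1ℚ))) * bit t
      expand x β true  = solve 2
          (λ x β → (x :+ con 1ℚ) :* (β :* con (- 1ℚ)) :=
          β :* x :+ (:- (β :* (x :+ x :+ con 1ℚ))) :* con 1ℚ) refl x β
      expand x β false = solve 2
          (λ x β → (x :+ con 0ℚ) :* (β :* con 1ℚ) :=
          β :* x :+ (:- (β :* (x :+ x :+ con 1ℚ))) :* con 0ℚ) refl x β
      inner : ∀ a → 𝔼 {dim (D i)} (λ c → (F (suc i) (a ++ c) + K) * u (a ++ c))
          ≡ - ½ * bit ⟨ b , column i a ⟩
      inner a = begin
        𝔼 (λ c → (F (suc i) (a ++ c) + K) * u (a ++ c))
          ≡⟨ 𝔼-cong (λ c → cong₂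
              (λ a′ c′ → ((F i a′ + bit ⟨ c′ , column i a′ ⟩) + K)
                         * (bit ⟨ b , column i a′ ⟩ * sign ⟨ c′ , column i a′ ⟩))
              (take-++ a c) (drop-++ a c)) ⟩
        𝔼 (λ c → ((F i a + bit ⟨ c , column i a ⟩) + K) * (β * sign ⟨ c , column i a ⟩))
          ≡⟨ 𝔼-cong (λ c → trans
              (cong (_* (β * sign ⟨ c , column i a ⟩))
              (solve 3 (λ f t k → (f :+ t) :+ k := (f :+ k) :+ t) refl (F i a)
              (bit ⟨ c , column i a ⟩) K)) (expand X β ⟨ c , column i a ⟩)) ⟩
        𝔼 (λ c → β * X + (- (β * (X + X + 1ℚ))) * bit ⟨ c , column i a ⟩)
          ≡⟨ 𝔼-affine (β * X) (- (β * (X + X + 1ℚ))) (λ c → bit ⟨ c , column i a ⟩) ⟩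
        β * X + (- (β * (X + X + 1ℚ))) * 𝔼 (λ c → bit ⟨ c , column i a ⟩)
          ≡⟨ cong (λ t → β * X + (- (β * (X + X + 1ℚ))) * t)
              (𝔼-bit-inner (code (D i) .ξ-nonZero a)) ⟩
        β * X + (- (β * (X + X + 1ℚ))) * ½
          ≡⟨ solve 2 (λ β x → β :* x :+ (:- (β :* (x :+ x :+ con 1ℚ))) :* con ½ :=
              con (- ½) :* β) refl β X ⟩
        - ½ * β ∎
        where
        X = F i a + K
        β = bit ⟨ b , column i a ⟩

  -- Regular subspaces for the tower function are trivial.

  ≤′-pred : ∀ {i s} → suc i ≤′ s → i ≤′ s
  ≤′-pred ≤′-refl     = ≤′-step ≤′-refl
  ≤′-pred (≤′-step p) = ≤′-step (≤′-pred p)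

  proj-prefix : ∀ {i s} (p : suc i ≤′ s) x → prefix i (proj p x) ≡ proj (≤′-pred p) x
  proj-prefix ≤′-refl             x = refl
  proj-prefix (≤′-step {n = s} p) x = proj-prefix p (prefix s x)

  T⇒≡true : ∀ {b} → T b → b ≡ true
  T⇒≡true {true} _ = refl

  -- The second hypothesis is s ≤ 1/(16ε) without a division. It enters as 16ε ≤ r with r = 1/s,
  -- that is, 2ε ≤ r/8.
  module _ (s′ : ℕ) {ε : ℚ} (0<ε : 0ℚ < ε) (16εs≤1 : (⌜ 16 ⌝ * ε) * ⌜ suc s′ ⌝ ≤ 1ℚ) where

    private
      s = suc s′
      r = 1 ÷ℕ s

      sr≡1 : ⌜ s ⌝ * r ≡ 1ℚ
      sr≡1 = *-÷ℕ-cancel 1 s′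

      r>0 : Positive r
      r>0 = normalize-pos 1 s

      0≤r : 0ℚ ≤ r
      0≤r = <⇒≤ (positive⁻¹ r {{r>0}})

      16ε≤r : ⌜ 16 ⌝ * ε ≤ r
      16ε≤r = begin
        ⌜ 16 ⌝ * ε                       ≡⟨ *-identityʳ _ ⟨
        (⌜ 16 ⌝ * ε) * 1ℚ                ≡⟨ cong ((⌜ 16 ⌝ * ε) *_) sr≡1 ⟨
        (⌜ 16 ⌝ * ε) * (⌜ s ⌝ * r)
          ≡⟨ solve 3 (λ a b c → a :* (b :* c) := c :* (a :* b)) refl (⌜ 16 ⌝ * ε) ⌜ s ⌝ r ⟩
        r * ((⌜ 16 ⌝ * ε) * ⌜ s ⌝)       ≤⟨ *-monoˡ-≤ 0≤r 16εs≤1 ⟩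
        r * 1ℚ                           ≡⟨ *-identityʳ r ⟩
        r                                ∎
        where
        open ≤-Reasoning
        open ℚ-Solver

      r≤1 : r ≤ 1ℚ
      r≤1 = begin
        r             ≡⟨ *-identityʳ r ⟨
        r * 1ℚ        ≤⟨ *-monoˡ-≤ 0≤r (⌜⌝-mono {1} {s} (ℕ.s≤s ℕ.z≤n)) ⟩
        r * ⌜ s ⌝     ≡⟨ *-comm r ⌜ s ⌝ ⟩
        ⌜ s ⌝ * r     ≡⟨ sr≡1 ⟩
        1ℚ            ∎
        where open ≤-Reasoning

      0≤1-ε : 0ℚ ≤ 1ℚ - ε
      0≤1-ε = begin
        0ℚ            ≡⟨ +-inverseʳ ε ⟨
        ε - ε         ≤⟨ +-monoˡ-≤ (- ε) (begin
          ε                        ≡⟨ *-identityʳ ε ⟨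
          ε * 1ℚ                   ≤⟨ *-monoˡ-≤ (<⇒≤ 0<ε) (≤ᵇ⇒≤ {1ℚ} {⌜ 16 ⌝} _) ⟩
          ε * ⌜ 16 ⌝               ≡⟨ *-comm ε ⌜ 16 ⌝ ⟩
          ⌜ 16 ⌝ * ε               ≤⟨ 16ε≤r ⟩
          r                        ≤⟨ r≤1 ⟩
          1ℚ                       ∎) ⟩
        1ℚ - ε        ∎
        where open ≤-Reasoning

    towerFunction : 𝔽₂^ (D s) → ℚ
    towerFunction x = r * F s x

    towerFunction-bounds : ∀ x → 0ℚ ≤ towerFunction x × towerFunction x ≤ 1ℚ
    towerFunction-bounds x with F-bounds s x
    ... | 0≤F , F≤s =
      ≤-trans (≤-reflexive (sym (*-zeroʳ r))) (*-monoˡ-≤ 0≤r 0≤F) ,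
      ≤-trans (*-monoˡ-≤ 0≤r F≤s) (≤-reflexive (trans (*-comm r ⌜ s ⌝) sr≡1))

    module _ (H : Subspace (D s)) (regular : IsRegularSubspace ε towerFunction H) where

      private
        Vanishes : ∀ {i} → i ≤′ s → Set
        Vanishes p = ∀ h → T (mem H h) → proj p h ≡ 𝟎

        -- A nonzero block would close the chain 2ε ≤ r/8 ≤ minus the correlation ≤ 1 - (1 - ε)² =
        -- 2ε - ε² < 2ε. The second inequality is the code distance, the third is regularity.
        block-vanishes : ∀ {i} (p : suc i ≤′ s) → Vanishes (≤′-pred p) →
          ∀ h → T (mem H h) → ¬ NonZeroVec (block i (proj p h))
        block-vanishes {i} p vanishes h h∈H nz = <-irrefl refl (begin-strict
          ⌜ 2 ⌝ * ε
            ≡⟨ solve 1 (λ e → con ⌜ 2 ⌝ :* e := con (½ * ¼) :* (con ⌜ 16 ⌝ :* e)) refl ε ⟩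
          (½ * ¼) * (⌜ 16 ⌝ * ε)                       ≤⟨ *-monoˡ-≤-nonNeg (½ * ¼) 16ε≤r ⟩
          (½ * ¼) * r
            ≡⟨ solve 1 (λ r → con (½ * ¼) :* r := (r :* con ½) :* con ¼) refl r ⟩
          (r * ½) * ¼                                  ≤⟨ *-monoˡ-≤ 0≤r½ (code-density (D i) b nz) ⟩
          (r * ½) * 𝔼 (λ a → bit ⟨ b , column i a ⟩)
            ≡⟨ solve 2 (λ r e → (r :* con ½) :* e := :- (r :* (con (- ½) :* e))) refl r
                (𝔼 (λ a → bit ⟨ b , column i a ⟩)) ⟩
          - (r * (- ½ * 𝔼 (λ a → bit ⟨ b , column i a ⟩)))
            ≡⟨ cong (λ t → - (r * t)) (correlation-F p b) ⟨
          - (r * 𝔼 (λ x → F s x * (bit (tested p b x) * sign ⟨ x , frequency p b x ⟩)))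
            ≡⟨ cong -_ (𝔼-* r (λ x → F s x * (bit (tested p b x) * sign ⟨ x , frequency p b x ⟩))) ⟨
          - 𝔼 (λ x → r * (F s x * (bit (tested p b x) * sign ⟨ x , frequency p b x ⟩)))
            ≡⟨ cong -_ (𝔼-cong λ x → *-assoc r (F s x) _) ⟨
          - 𝔼 (λ x → towerFunction x * (bit (tested p b x) * sign ⟨ x , frequency p b x ⟩))
            ≤⟨ correlation-upper H towerFunction towerFunction-bounds regular (frequency p b)
                (tested p b)
                 (λ x g x-g∈H → cong (λ a → lift p (𝟎 ++ column i a)) (same-prefix x g x-g∈H))
                 (λ x g x-g∈H → cong (λ a → ⟨ b , column i a ⟩) (same-prefix x g x-g∈H))
                 nontrivial (<⇒≤ 0<ε) 0≤1-ε ⟩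
          1ℚ - (1ℚ - ε) * (1ℚ - ε)
            ≡⟨ solve 1 (λ e → con 1ℚ :- (con 1ℚ :- e) :* (con 1ℚ :- e) :=
                con ⌜ 2 ⌝ :* e :+ (:- (e :* e))) refl ε ⟩
          ⌜ 2 ⌝ * ε + - (ε * ε)
            <⟨ +-monoʳ-< (⌜ 2 ⌝ * ε)
                (neg-antimono-<
                (positive⁻¹ (ε * ε) {{pos*pos⇒pos ε {{positive 0<ε}} ε {{positive 0<ε}}}})) ⟩
          ⌜ 2 ⌝ * ε + 0ℚ                               ≡⟨ +-identityʳ _ ⟩
          ⌜ 2 ⌝ * ε                                    ∎)
          where
          open ≤-Reasoning
          open ℚ-Solver
          b = block i (proj p h)
          0≤r½ : 0ℚ ≤ r * ½
          0≤r½ = ≤-trans (≤-reflexive (sym (*-zeroʳ r))) (*-monoˡ-≤ 0≤r (≤ᵇ⇒≤ {0ℚ} {½} _))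
          -- Elements of H have zero prefix, so the points of a coset share theirs; frequency and
          -- test depend on nothing else.
          same-prefix : ∀ x g → T (mem H (x ⊕ g)) → prefix i (proj p x) ≡ prefix i (proj p g)
          same-prefix x g x-g∈H = trans (proj-prefix p x) (trans
            (⊕≡𝟎⇒≡ _ _ (trans (sym (proj-⊕ (≤′-pred p) x g)) (vanishes (x ⊕ g) x-g∈H)))
            (sym (proj-prefix p g)))
          -- The element h itself witnesses that H is not orthogonal to the frequency.
          nontrivial : ∀ g → tested p b g ≡ true → ¬ T (inPerp H (frequency p b g))
          nontrivial g tested-g perp = contradiction
              (trans (sym hit)
              (#-zero (λ y → mem H y ∧ ⟨ y , frequency p b g ⟩) (ℕₚ.≡ᵇ⇒≡ _ 0 perp) h)) λ ()
            where
            hit : mem H h ∧ ⟨ h , frequency p b g ⟩ ≡ true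
            hit = cong₂ _∧_ (T⇒≡true h∈H)
                (trans (inner-lift p h _) (trans (inner-𝟎++ (D i) (proj p h) _) tested-g))

        -- Induction over the blocks from the first one: the prefix vanishes by induction, the next
        -- block by `block-vanishes`.
        vanishing : ∀ {i} (p : i ≤′ s) → Vanishes p
        vanishing {zero} p h _ with proj p h
        ... | [] = refl
        vanishing {suc i} p h h∈H with zeroOrNonZero (block i (proj p h))
        ... | inj₂ nz = ⊥-elim (block-vanishes p (vanishing (≤′-pred p)) h h∈H nz)
        ... | inj₁ b≡𝟎 = trans (sym (take++drop≡id (D i) (proj p h))) (trans
          (cong₂ _++_ (trans (proj-prefix p h) (vanishing (≤′-pred p) h h∈H)) b≡𝟎) (𝟎-++ (D i)))

      regular⇒trivial : ∀ h → T (mem H h) → h ≡ 𝟎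
      regular⇒trivial = vanishing ≤′-refl

  #-singleton : ∀ {n} (p : 𝔽₂^ n → Bool) → (∀ x → T (p x) → x ≡ 𝟎) → # p ℕ.≤ 1
  #-singleton {zero} p _ with p []
  ... | true  = ℕₚ.≤-refl
  ... | false = ℕ.z≤n
  #-singleton {suc n} p only𝟎 with search (p ∘ (true ∷_))
  ... | inj₁ (x , t) with () ← only𝟎 (true ∷ x) t
  ... | inj₂ none = begin
    # p
      ≡⟨ trans (#-suc p) (trans (cong (# (p ∘ (false ∷_)) ℕ.+_) none) (ℕₚ.+-identityʳ _)) ⟩
    # (p ∘ (false ∷_))
      ≤⟨ #-singleton (p ∘ (false ∷_)) (λ x t → cong Vec.tail (only𝟎 (false ∷ x) t)) ⟩
    1                                              ∎
    where open ℕₚ.≤-Reasoning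

  -- Index of the trivial subspace, the floor of 1/(16ε), and the tower bound.

  trivial⇒2^≤index : ∀ {n} (H : Subspace n) → (∀ h → T (mem H h) → h ≡ 𝟎) → 2 ℕ.^ n ℕ.≤ index H
  trivial⇒2^≤index {n} H only𝟎 = begin
    2 ℕ.^ n              ≡⟨ index-card H ⟨
    index H ℕ.* card H   ≤⟨ ℕₚ.*-monoʳ-≤ (index H) (#-singleton (mem H) only𝟎) ⟩
    index H ℕ.* 1        ≡⟨ ℕₚ.*-identityʳ (index H) ⟩
    index H              ∎
    where open ℕₚ.≤-Reasoning

  1≤index : ∀ {n} (H : Subspace n) → 1 ℕ.≤ index H
  1≤index {n} H = ℕₚ.n≢0⇒n>0 λ index≡0 →
    ℕ.≢-nonZero⁻¹ (2 ℕ.^ n) {{ℕₚ.m^n≢0 2 n}}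
        (trans (sym (index-card H)) (cong (ℕ._* card H) index≡0))

  -- For q ≥ 0 the integer floor is nonnegative, so taking its absolute value does not change it.
  ∣floor∣≤ : ∀ q → 0ℚ ≤ q → ⌜ ℤ.∣ floor q ∣ ⌝ ≤ q
  ∣floor∣≤ q@(mkℚ n d _) 0≤q = toℚᵘ-cancel-≤ (begin
    toℚᵘ ⌜ k ⌝            ≃⟨ toℚᵘ-fromℚᵘ (ℚᵘ.mkℚᵘ (ℤ.+ k) 0) ⟩
    ℚᵘ.mkℚᵘ (ℤ.+ k) 0
      ≤⟨ ℚᵘ.*≤* (subst₂ ℤ._≤_ (cong (ℤ._* ℤ.+ suc d) (sym +k≡)) (sym (ℤₚ.*-identityʳ n))
          (ℤ.[n/d]*d≤n n (ℤ.+ suc d))) ⟩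
    toℚᵘ q                ∎)
    where
    open ℚᵘₚ.≤-Reasoning
    k = ℤ.∣ floor q ∣
    0≤n : ℤ.0ℤ ℤ.≤ n
    0≤n = subst₂ ℤ._≤_ (ℤₚ.*-zeroˡ (ℤ.+ suc d)) (ℤₚ.*-identityʳ n) (drop-*≤* 0≤q)
    +k≡ : ℤ.+ k ≡ n ℤ./ ℤ.+ suc d
    +k≡ = ℤₚ.0≤i⇒+∣i∣≡i (ℤ.0≤n⇒0≤n/d n (ℤ.+ suc d) 0≤n (ℤ.+≤+ ℕ.z≤n))

  tower-lower-bound : ∀ s {ε} → 0ℚ < ε → (⌜ 16 ⌝ * ε) * ⌜ s ⌝ ≤ 1ℚ →
    Σ ℕ λ n → 1 ℕ.≤ n × Σ (𝔽₂^ n → ℚ) λ f →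
      (∀ x → 0ℚ ≤ f x × f x ≤ 1ℚ) ×
      (∀ (H : Subspace n) → IsRegularSubspace ε f H → twr s ℕ.≤ index H)
  -- The bound is `twr 0` = 1 here, so any function serves; n = 1 meets the demand that n be
  -- positive.
  tower-lower-bound zero 0<ε _ =
    1 , ℕₚ.≤-refl , (λ _ → 0ℚ) , (λ _ → ≤-refl , ≤ᵇ⇒≤ _) , λ H _ → 1≤index H
  tower-lower-bound (suc s) 0<ε 16εs≤1 =
    D (suc s) , ℕₚ.≤-trans (1≤twr s) (twr≤D s) ,
    towerFunction s 0<ε 16εs≤1 , towerFunction-bounds s 0<ε 16εs≤1 ,
    -- The index 2 ^ `D (suc s)` of the trivial subspace supplies the top level of the tower, so
    -- `D (suc s)` has to reach only `twr s`.
    λ H regular → ℕₚ.≤-trans (ℕₚ.^-monoʳ-≤ 2 (twr≤D s))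
      (trivial⇒2^≤index H (regular⇒trivial s 0<ε 16εs≤1 H regular))
    where
    1≤twr : ∀ i → 1 ℕ.≤ twr i
    1≤twr zero    = ℕₚ.≤-refl
    1≤twr (suc i) = ℕₚ.≤-trans (ℕ.s≤s ℕ.z≤n) (2≤twr i)

  *-∣floor-1/∣≤1 : ∀ q .{{_ : Positive q}} → q * ⌜ ℤ.∣ floor ((1/ q) {{pos⇒nonZero q}}) ∣ ⌝ ≤ 1ℚ
  *-∣floor-1/∣≤1 q = begin
    q * ⌜ ℤ.∣ floor (1/ q) ∣ ⌝
      ≤⟨ *-monoˡ-≤ (<⇒≤ (positive⁻¹ q))
          (∣floor∣≤ (1/ q) (<⇒≤ (positive⁻¹ (1/ q) {{1/pos⇒pos q}}))) ⟩
    q * 1/ q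
      ≡⟨ *-inverseʳ q ⟩
    1ℚ ∎
    where
    open ≤-Reasoning
    instance
      q-nonZero : NonZero q
      q-nonZero = pos⇒nonZero q

open import Data.Nat using (ℕ; _≤_)
open import Data.Rational using (ℚ; 0ℚ; 1ℚ; _<_) renaming (_≤_ to _≤ℚ_)
open import Data.Product using (Σ; _×_)

theorem2 : (ε : ℚ) → (ε>0 : 0ℚ < ε) →
    Σ ℕ λ n → 1 ≤ n × Σ (𝔽₂^ n → ℚ) λ f →
    (∀ x → 0ℚ ≤ℚ f x × f x ≤ℚ 1ℚ) ×
    (∀ (H : Subspace n) → IsRegularSubspace ε f H → towerBound ε ε>0 ≤ index H)
theorem2 ε ε>0 = tower-lower-bound s ε>0 (*-∣floor-1/∣≤1 16ε {{16ε-positive}})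
  where
  open Regularity
  16ε : ℚ
  16ε = ⌜ 16 ⌝ ℚ.* ε
  16ε-positive : ℚ.Positive 16ε
  16ε-positive = ℚₚ.pos*pos⇒pos ⌜ 16 ⌝ ε {{ℚ.positive ε>0}}
  s : ℕ
  s = ℤ.∣ ℚ.floor ((ℚ.1/ 16ε) {{ℚₚ.pos⇒nonZero 16ε {{16ε-positive}}}}) ∣
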